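{- Let $\varepsilon\in(0,1)$, let $n_1\neq n_2$ be integers with $n_1,n_2\ge 2$, and let $u_1,u_2$ be vertices of the complete graphs $G_1=K_{n_1}$ and $G_2=K_{n_2}$ respectively. Then $(G_1,u_1)$ and $(G_2,u_2)$ are distinguishable either by $S^{(1)}$ or by $S^{(2)}$.
   Context: Noisy voter model (NVM) with noise $\varepsilon\in(0,1)$ on a connected (locally finite, with at least two vertices) graph $G$: let $N_G(u)$ be the set of neighbors of $u$. At time $0$, $X_0(u)\sim\mathrm{Bern}(1/2)$ independently over all $u\in V(G)$. For every $t\ge 1$ and $u\in V(G)$, $$X_t(u)=\xi_t(u)Y_t(u)+(1-\xi_t(u))\sum_{v\in N_G(u)}I(\eta_t(u)=v)X_{t-1}(v),$$ where $\xi_t(u)\sim\mathrm{Bern}(\varepsilon)$, $Y_t(u)\sim\mathrm{Bern}(1/2)$, $\eta_t(u)$ is uniform on $N_G(u)$, and all the variables $\xi_t(u),Y_t(u),\eta_t(u)$ ($t\ge1$, $u\in V(G)$) and $X_0(u)$ ($u\in V(G)$) are independent. Write $X_t(G,u)=X_t(u)$. Distinguishability: let $(G_1,u_1),(G_2,u_2)$ be rooted graphs, both running the NVM with the same $\varepsilon$. They are distinguishable by a sequence $S=(S_t)_{t}$, where $S_t$ is a real-valued function of the observations up to time $t$ at a vertex, if there are sets $\mathcal S_1(t),\mathcal S_2(t)\subset\mathbb R$, disjoint for each $t$, such that $$\mathsf P\big[S_t(X_i(G_1,u_1),\,i\le t)\in\mathcal S_1(t),\ S_t(X_i(G_2,u_2),\,i\le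 t)\in\mathcal S_2(t)\big]\to1\quad (t\to\infty).$$ Repetition statistic: for $d\in\mathbb N$ and $t>d$, $S^{(d)}_t=\frac1{t-d}\sum_{i=1}^{t-d}I(X_i(u)=X_{i+d}(u))$, where $u$ is the observed vertex, and $S^{(d)}=(S^{(d)}_t)_t$. -}

module Defs where

open import Data.Bool.Base using (Bool; true; false; if_then_else_)
open import Data.Bool.Properties using () renaming (_≟_ to _≟ᵇ_)
open import Data.Empty using (⊥-elim)
open import Data.Fin.Base using (Fin; zero; suc; toℕ; fromℕ<)
open import Data.Fin.Properties using (toℕ<n) renaming (_≟_ to _≟ᶠ_)
open import Data.Integer.Base using (+_)
open import Data.List.Base as List using (List; []; _∷_; allFin; cartesianProductWith; filter; length)
open import Data.List.Membership.Propositional using (_∈_)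
open import Data.List.Membership.Propositional.Properties using (∈-filter⁺; ∈-allFin)
open import Data.List.Relation.Unary.Any using (here; there)
open import Data.Nat.Base as ℕ using (ℕ; zero; suc; _∸_; z≤n; s≤s)
import Data.Nat.Properties as ℕ
open import Data.Product using (Σ; Σ-syntax; ∃-syntax; _×_; _,_; proj₁; proj₂; map₂; uncurry)
open import Data.Rational.Base as ℚ using (ℚ; 0ℚ; 1ℚ; ½; positive; 1/_; nonNegative)
import Data.Rational.Properties as ℚ
open import Data.Rational.Solver using (module +-*-Solver)
open import Data.Vec.Base as Vec using (Vec; []; _∷_; lookup)
open import Level using (0ℓ)
open import Relation.Binary.Construct.Closure.ReflexiveTransitive using (Star; ε; _◅_)
open import Relation.Binary.Core using (Rel)
import Relation.Binary.Definitions as B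
open import Relation.Binary.PropositionalEquality
open import Relation.Nullary using (¬_; does; yes; no; ¬?)
open import Relation.Unary using (Pred; Decidable)

-- Real numbers: Cauchy sequences of rationals, with equality _≈_ meaning
-- that the difference tends to 0.  All operations act termwise.

record ℝ : Set where
  constructor mkℝ
  field
    seq    : ℕ → ℚ
    cauchy : ∀ δ → 0ℚ ℚ.< δ →
             ∃[ N ] (∀ m n → N ℕ.≤ m → N ℕ.≤ n → ℚ.∣ seq m ℚ.- seq n ∣ ℚ.≤ δ)

open ℝ public

infix 4 _≈_ _<_
infixl 6 _+_ _-_
infixl 7 _*_

_≈_ : Rel ℝ 0ℓ
x ≈ y = ∀ δ → 0ℚ ℚ.< δ →
        ∃[ N ] (∀ n → N ℕ.≤ n → ℚ.∣ seq x n ℚ.- seq y n ∣ ℚ.≤ δ)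

_<_ : Rel ℝ 0ℓ
x < y = ∃[ δ ] 0ℚ ℚ.< δ × ∃[ N ] (∀ n → N ℕ.≤ n → seq x n ℚ.+ δ ℚ.≤ seq y n)

fromℚ : ℚ → ℝ
fromℚ q = mkℝ (λ _ → q) λ δ 0<δ → 0 , λ _ _ _ _ → begin
  ℚ.∣ q ℚ.- q ∣  ≡⟨ cong ℚ.∣_∣ (ℚ.+-inverseʳ q) ⟩
  0ℚ             ≤⟨ ℚ.<⇒≤ 0<δ ⟩
  δ              ∎
  where open ℚ.≤-Reasoning

0ℝ 1ℝ : ℝ
0ℝ = fromℚ 0ℚ
1ℝ = fromℚ 1ℚ

-_ : ℝ → ℝ
- x = mkℝ (λ n → ℚ.- seq x n) λ δ 0<δ →
  let N , close = cauchy x δ 0<δ in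
  N , λ m n N≤m N≤n → begin
    ℚ.∣ ℚ.- seq x m ℚ.- (ℚ.- seq x n) ∣  ≡⟨ cong ℚ.∣_∣ (sym (ℚ.neg-distrib-+ (seq x m) (ℚ.- seq x n))) ⟩
    ℚ.∣ ℚ.- (seq x m ℚ.- seq x n) ∣      ≡⟨ ℚ.∣-p∣≡∣p∣ (seq x m ℚ.- seq x n) ⟩
    ℚ.∣ seq x m ℚ.- seq x n ∣            ≤⟨ close m n N≤m N≤n ⟩
    δ                                    ∎
  where open ℚ.≤-Reasoning

_+_ : ℝ → ℝ → ℝ
x + y = mkℝ (λ n → seq x n ℚ.+ seq y n) λ δ 0<δ →
  let 0<δ/2   = subst (ℚ._< ½ ℚ.* δ) (ℚ.*-zeroʳ ½) (ℚ.*-monoʳ-<-pos ½ 0<δ)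
      N₁ , c₁ = cauchy x (½ ℚ.* δ) 0<δ/2
      N₂ , c₂ = cauchy y (½ ℚ.* δ) 0<δ/2
  in N₁ ℕ.⊔ N₂ , λ m n N≤m N≤n →
  let a = seq x m; b = seq x n; c = seq y m; d = seq y n in begin
    ℚ.∣ (a ℚ.+ c) ℚ.- (b ℚ.+ d) ∣             ≡⟨ cong ℚ.∣_∣ (rearrange a b c d) ⟩
    ℚ.∣ (a ℚ.- b) ℚ.+ (c ℚ.- d) ∣             ≤⟨ ℚ.∣p+q∣≤∣p∣+∣q∣ (a ℚ.- b) (c ℚ.- d) ⟩
    ℚ.∣ a ℚ.- b ∣ ℚ.+ ℚ.∣ c ℚ.- d ∣           ≤⟨ ℚ.+-mono-≤
                                                   (c₁ m n (ℕ.m⊔n≤o⇒m≤o N₁ N₂ N≤m) (ℕ.m⊔n≤o⇒m≤o N₁ N₂ N≤n))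
                                                   (c₂ m n (ℕ.m⊔n≤o⇒n≤o N₁ N₂ N≤m) (ℕ.m⊔n≤o⇒n≤o N₁ N₂ N≤n)) ⟩
    ½ ℚ.* δ ℚ.+ ½ ℚ.* δ                       ≡⟨ ℚ.*-distribʳ-+ δ ½ ½ ⟨
    1ℚ ℚ.* δ                                  ≡⟨ ℚ.*-identityˡ δ ⟩
    δ                                         ∎
  where
  open ℚ.≤-Reasoning
  rearrange : ∀ a b c d → (a ℚ.+ c) ℚ.- (b ℚ.+ d) ≡ (a ℚ.- b) ℚ.+ (c ℚ.- d)
  rearrange = solve 4 (λ a b c d → (a :+ c) :- (b :+ d) := (a :- b) :+ (c :- d)) refl
    where open +-*-Solver

_-_ : ℝ → ℝ → ℝ
x - y = x + (- y)

private
  eventuallyBounded : ∀ x → ∃[ C ] 0ℚ ℚ.< C × ∃[ N ] (∀ n → N ℕ.≤ n → ℚ.∣ seq x n ∣ ℚ.≤ C)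
  eventuallyBounded x =
    let N , close = cauchy x 1ℚ (ℚ.positive⁻¹ 1ℚ)
        b = seq x N
    in 1ℚ ℚ.+ ℚ.∣ b ∣ , ℚ.+-mono-<-≤ (ℚ.positive⁻¹ 1ℚ) (ℚ.0≤∣p∣ b) , N , λ n N≤n →
    let a = seq x n in begin
      ℚ.∣ a ∣                        ≡⟨ cong ℚ.∣_∣ (split a b) ⟩
      ℚ.∣ (a ℚ.- b) ℚ.+ b ∣          ≤⟨ ℚ.∣p+q∣≤∣p∣+∣q∣ (a ℚ.- b) b ⟩
      ℚ.∣ a ℚ.- b ∣ ℚ.+ ℚ.∣ b ∣      ≤⟨ ℚ.+-monoˡ-≤ ℚ.∣ b ∣ (close n N N≤n ℕ.≤-refl) ⟩
      1ℚ ℚ.+ ℚ.∣ b ∣                 ∎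
    where
    open ℚ.≤-Reasoning
    split : ∀ a b → a ≡ (a ℚ.- b) ℚ.+ b
    split = solve 2 (λ a b → a := (a :- b) :+ b) refl
      where open +-*-Solver

  productBound : ∀ p q {C D} → ℚ.∣ p ∣ ℚ.≤ C → ℚ.∣ q ∣ ℚ.≤ D → ℚ.∣ p ℚ.* q ∣ ℚ.≤ C ℚ.* D
  productBound p q {C} {D} p≤C q≤D = begin
    ℚ.∣ p ℚ.* q ∣          ≡⟨ ℚ.∣p*q∣≡∣p∣*∣q∣ p q ⟩
    ℚ.∣ p ∣ ℚ.* ℚ.∣ q ∣    ≤⟨ ℚ.*-monoʳ-≤-nonNeg ℚ.∣ q ∣ {{ℚ.∣-∣-nonNeg q}} p≤C ⟩
    C ℚ.* ℚ.∣ q ∣          ≤⟨ ℚ.*-monoˡ-≤-nonNeg C {{nonNegative (ℚ.≤-trans (ℚ.0≤∣p∣ p) p≤C)}} q≤D ⟩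
    C ℚ.* D                ∎
    where open ℚ.≤-Reasoning

  productDifference : ∀ a b c d {C D δ} →
    ℚ.∣ a ∣ ℚ.≤ C → ℚ.∣ d ∣ ℚ.≤ D → ℚ.∣ a ℚ.- b ∣ ℚ.≤ δ → ℚ.∣ c ℚ.- d ∣ ℚ.≤ δ →
    ℚ.∣ a ℚ.* c ℚ.- b ℚ.* d ∣ ℚ.≤ (C ℚ.+ D) ℚ.* δ
  productDifference a b c d {C} {D} {δ} a≤C d≤D a-b≤δ c-d≤δ = begin
    ℚ.∣ a ℚ.* c ℚ.- b ℚ.* d ∣                          ≡⟨ cong ℚ.∣_∣ (rearrange a b c d) ⟩
    ℚ.∣ a ℚ.* (c ℚ.- d) ℚ.+ d ℚ.* (a ℚ.- b) ∣          ≤⟨ ℚ.∣p+q∣≤∣p∣+∣q∣ (a ℚ.* (c ℚ.- d)) (d ℚ.* (a ℚ.- b)) ⟩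
    ℚ.∣ a ℚ.* (c ℚ.- d) ∣ ℚ.+ ℚ.∣ d ℚ.* (a ℚ.- b) ∣    ≤⟨ ℚ.+-mono-≤ (productBound a (c ℚ.- d) a≤C c-d≤δ)
                                                                      (productBound d (a ℚ.- b) d≤D a-b≤δ) ⟩
    C ℚ.* δ ℚ.+ D ℚ.* δ                                ≡⟨ ℚ.*-distribʳ-+ δ C D ⟨
    (C ℚ.+ D) ℚ.* δ                                    ∎
    where
    open ℚ.≤-Reasoning
    rearrange : ∀ a b c d → a ℚ.* c ℚ.- b ℚ.* d ≡ a ℚ.* (c ℚ.- d) ℚ.+ d ℚ.* (a ℚ.- b)
    rearrange = solve 4 (λ a b c d → a :* c :- b :* d := a :* (c :- d) :+ d :* (a :- b)) refl
      where open +-*-Solver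

  portion : ∀ E δ → 0ℚ ℚ.< E → 0ℚ ℚ.< δ → ∃[ δ′ ] 0ℚ ℚ.< δ′ × E ℚ.* δ′ ≡ δ
  portion E δ 0<E 0<δ =
    1/ E ℚ.* δ ,
    ℚ.positive⁻¹ (1/ E ℚ.* δ) {{ℚ.pos*pos⇒pos (1/ E) {{ℚ.1/pos⇒pos E}} δ {{positive 0<δ}}}} ,
    trans (sym (ℚ.*-assoc E (1/ E) δ))
      (trans (cong (ℚ._* δ) (ℚ.*-inverseʳ E)) (ℚ.*-identityˡ δ))
    where
    instance
      E>0 : ℚ.Positive E
      E>0 = positive 0<E
      E≢0 : ℚ.NonZero E
      E≢0 = ℚ.pos⇒nonZero E

_*_ : ℝ → ℝ → ℝ
x * y = mkℝ (λ n → seq x n ℚ.* seq y n) λ δ 0<δ →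
  let C , 0<C , M₁ , b₁ = eventuallyBounded x
      D , 0<D , M₂ , b₂ = eventuallyBounded y
      δ′ , 0<δ′ , eq    = portion (C ℚ.+ D) δ (ℚ.+-mono-< 0<C 0<D) 0<δ
      N₁ , c₁           = cauchy x δ′ 0<δ′
      N₂ , c₂           = cauchy y δ′ 0<δ′
      M = M₁ ℕ.⊔ M₂
      N = N₁ ℕ.⊔ N₂
      boundsˡ = λ {k} (p : M ℕ.⊔ N ℕ.≤ k) → ℕ.m⊔n≤o⇒m≤o M N p
      boundsʳ = λ {k} (p : M ℕ.⊔ N ℕ.≤ k) → ℕ.m⊔n≤o⇒n≤o M N p
  in M ℕ.⊔ N , λ m n p q → subst (ℚ._≤_ _) eq
    (productDifference (seq x m) (seq x n) (seq y m) (seq y n)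
      (b₁ m (ℕ.m⊔n≤o⇒m≤o M₁ M₂ (boundsˡ p)))
      (b₂ n (ℕ.m⊔n≤o⇒n≤o M₁ M₂ (boundsˡ q)))
      (c₁ m n (ℕ.m⊔n≤o⇒m≤o N₁ N₂ (boundsʳ p)) (ℕ.m⊔n≤o⇒m≤o N₁ N₂ (boundsʳ q)))
      (c₂ m n (ℕ.m⊔n≤o⇒n≤o N₁ N₂ (boundsʳ p)) (ℕ.m⊔n≤o⇒n≤o N₁ N₂ (boundsʳ q))))

infix 4 _⟶_

_⟶_ : (ℕ → ℝ) → ℝ → Set
a ⟶ L = ∀ δ → 0ℝ < δ → ∃[ T ] (∀ t → T ℕ.≤ t → L - δ < a t × a t < L + δ)

-- A set of reals has to be invariant under equality of reals.
record Subsetℝ : Set₁ where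
  field
    _∋_      : Pred ℝ 0ℓ
    respects : _∋_ B.Respects _≈_

open Subsetℝ public

Disjoint : Rel Subsetℝ 0ℓ
Disjoint A B = ∀ x → ¬ ((A ∋ x) × (B ∋ x))

-- Finite probability spaces: lists of weighted sample points (a point may
-- occur several times, its probability then being the total weight).

Dist : Set → Set
Dist A = List (ℝ × A)

bern : ℝ → Dist Bool
bern p = (p , true) ∷ (1ℝ - p , false) ∷ []

uniform : ∀ {A : Set} (xs : List A) → .{{ℕ.NonZero (length xs)}} → Dist A
uniform xs = List.map (λ x → fromℚ (+ 1 ℚ./ length xs) , x) xs

-- Product measures, i.e. joint laws of independent variables.
infixr 5 _⊗_

_⊗_ : ∀ {A B : Set} → Dist A → Dist B → Dist (A × B)
_⊗_ = cartesianProductWith λ (p , x) (q , y) → p * q , (x , y)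

⨂ : ∀ {A : Set} {n} → (Fin n → Dist A) → Dist (Vec A n)
⨂ {n = zero}  μ = (1ℝ , []) ∷ []
⨂ {n = suc n} μ = List.map (map₂ (uncurry _∷_)) (μ zero ⊗ ⨂ (λ i → μ (suc i)))

ℙ[_] : ∀ {A : Set} {E : Pred A 0ℓ} → Decidable E → Dist A → ℝ
ℙ[ E? ] []            = 0ℝ
ℙ[ E? ] ((p , x) ∷ μ) = (if does (E? x) then p else 0ℝ) + ℙ[ E? ] μ

record Graph : Set₁ where
  infix 4 _∼_ _∼?_
  field
    order     : ℕ
    2≤order   : 2 ℕ.≤ order
    _∼_       : Rel (Fin order) 0ℓ
    _∼?_      : B.Decidable _∼_
    ∼-sym     : B.Symmetric _∼_
    ∼-irrefl  : ∀ u → ¬ (u ∼ u)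
    connected : ∀ u v → Star _∼_ u v

  Vertex : Set
  Vertex = Fin order

  neighbours : Vertex → List Vertex
  neighbours u = filter (u ∼?_) (allFin order)

  hasNeighbour : ∀ u → ∃[ v ] u ∼ v
  hasNeighbour u = first (connected u (proj₁ (another 2≤order u))) (proj₂ (another 2≤order u))
    where
    another : ∀ {n} → 2 ℕ.≤ n → (u : Fin n) → ∃[ v ] u ≢ v
    another (s≤s (s≤s _)) zero    = suc zero , λ ()
    another (s≤s (s≤s _)) (suc _) = zero , λ ()
    first : ∀ {v} → Star _∼_ u v → u ≢ v → ∃[ w ] u ∼ w
    first ε         u≢u = ⊥-elim (u≢u refl)
    first (u∼w ◅ _) _   = _ , u∼w

  degree≢0 : ∀ u → ℕ.NonZero (length (neighbours u))
  degree≢0 u = nonEmpty (∈-filter⁺ (u ∼?_) (∈-allFin (proj₁ (hasNeighbour u))) (proj₂ (hasNeighbour u)))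
    where
    nonEmpty : ∀ {v} {xs : List Vertex} → v ∈ xs → ℕ.NonZero (length xs)
    nonEmpty (here _)  = _
    nonEmpty (there _) = _

RootedGraph : Set₁
RootedGraph = Σ Graph Graph.Vertex

K : (n : ℕ) → 2 ℕ.≤ n → Graph
K n 2≤n = record
  { order     = n
  ; 2≤order   = 2≤n
  ; _∼_       = _≢_
  ; _∼?_      = λ u v → ¬? (u ≟ᶠ v)
  ; ∼-sym     = ≢-sym
  ; ∼-irrefl  = λ u u≢u → u≢u refl
  ; connected = path
  }
  where
  path : ∀ u v → Star _≢_ u v
  path u v with u ≟ᶠ v
  ... | yes refl = ε
  ... | no  u≢v  = u≢v ◅ ε

module NVM (e : ℝ) (G : Graph) where
  open Graph G

  State : Set
  State = Vec Bool order

  -- The variables ξ_t(u), Y_t(u), η_t(u) at one vertex and one time.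
  record Site : Set where
    constructor site
    field
      ξ : Bool
      Y : Bool
      η : Vertex

  siteLaw : Vertex → Dist Site
  siteLaw u = List.map (map₂ λ (ξ , Y , η) → site ξ Y η)
    (bern e ⊗ bern (fromℚ ½) ⊗ uniform (neighbours u) {{degree≢0 u}})

  -- X₀ and the variables at times 1, …, t: everything that determines
  -- X₀, …, X_t.
  Ω : ℕ → Set
  Ω t = State × Vec (Vec Site order) t

  law : ∀ t → Dist (Ω t)
  law t = ⨂ (λ _ → bern (fromℚ ½)) ⊗ ⨂ (λ _ → ⨂ siteLaw)

  -- The sum over v of I(η(u) = v) X(v) is X(η(u)).
  step : Vec Site order → State → State
  step ν x = Vec.tabulate λ u → let open Site (lookup ν u) in
    if ξ then Y else lookup x η

  run : ∀ {t} → State → Vec (Vec Site order) t → Vec State (suc t)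
  run x []       = x ∷ []
  run x (ν ∷ νs) = x ∷ run (step ν x) νs

  observe : ∀ {t} → Vertex → Ω t → Vec Bool (suc t)
  observe u (x₀ , νs) = Vec.map (λ x → lookup x u) (run x₀ νs)

-- S t is applied to (X₀(u), …, X_t(u)).
Statistic : Set
Statistic = ∀ t → Vec Bool (suc t) → ℝ

-- The two processes run independently of each other.  The component
-- E? says that the event is measurable: constructively, an event in a finite
-- probability space has a probability only if it is decidable, which
-- classically always holds.
Distinguishable : ℝ → RootedGraph → RootedGraph → Statistic → Set₁
Distinguishable e (G₁ , u₁) (G₂ , u₂) S =
  Σ[ 𝒮₁ ∈ (ℕ → Subsetℝ) ] Σ[ 𝒮₂ ∈ (ℕ → Subsetℝ) ]
    (∀ t → Disjoint (𝒮₁ t) (𝒮₂ t)) ×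
    Σ[ E? ∈ (∀ t → Decidable (event 𝒮₁ 𝒮₂ t)) ]
      (λ t → ℙ[ E? t ] (M₁.law t ⊗ M₂.law t)) ⟶ 1ℝ
  where
  module M₁ = NVM e G₁
  module M₂ = NVM e G₂
  event : (𝒮₁ 𝒮₂ : ℕ → Subsetℝ) → ∀ t → Pred (M₁.Ω t × M₂.Ω t) 0ℓ
  event 𝒮₁ 𝒮₂ t (ω₁ , ω₂) =
    (𝒮₁ t ∋ S t (M₁.observe u₁ ω₁)) × (𝒮₂ t ∋ S t (M₂.observe u₂ ω₂))

index< : ∀ t d k → k ℕ.≤ d → (i : Fin (t ∸ d)) → suc (toℕ i) ℕ.+ k ℕ.< suc t
index< t d k k≤d i = s≤s (begin
  suc (toℕ i) ℕ.+ k  ≤⟨ ℕ.+-mono-≤ (toℕ<n i) k≤d ⟩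
  (t ∸ d) ℕ.+ d      ≡⟨ ℕ.m∸n+n≡m {t} {d} (ℕ.<⇒≤ (ℕ.m∸n≢0⇒n<m (nonZero i))) ⟩
  t                  ∎)
  where
  open ℕ.≤-Reasoning
  nonZero : ∀ {n} → Fin n → n ≢ 0
  nonZero zero    ()
  nonZero (suc _) ()

-- The argument i : Fin (t ∸ d) stands for the time 1 + i ∈ {1, …, t - d}.
repeats : ∀ d t → Vec Bool (suc t) → Fin (t ∸ d) → Bool
repeats d t X i = does
  (lookup X (fromℕ< (index< t d 0 z≤n i)) ≟ᵇ lookup X (fromℕ< (index< t d d ℕ.≤-refl i)))

-- The empty average is a placeholder: it makes the repetition statistic 0
-- for t ≤ d, where it is not defined, with no bearing on limits as t → ∞.
average : ∀ {m} → (Fin m → Bool) → ℝ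
average {zero}  r = 0ℝ
average {suc m} r =
  fromℚ (+ Vec.sum (Vec.tabulate λ i → if r i then 1 else 0) ℚ./ suc m)

repetition : ℕ → Statistic
repetition d t X = average (repeats d t X)

{-# OPTIONS --safe #-}
module Submission where

-- The statistic S⁽¹⁾ always suffices.  In ±1 spins σ, with a = 1 - ε and
-- μ = 1/(n-1), two vertices of Kₙ copy the same neighbour with probability
-- o = μ - μ², so their stationary correlation ρ satisfies
-- ρ = a²(o + (1 - o)ρ), and E[σ_t(u) σ_{t+1}(u)] = aρ = a³o / (1 - a² + a²o).
-- This is strictly increasing in o, and o determines n.
--
-- For concentration, let S be the sum of all spins.  The span of 1, S² and
-- σ(u)S is invariant under the transition operator, so the Poisson equation
-- for σ_t(u) σ_{t+1}(u) has an explicit bounded solution h = αS² + βσ(u)S.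
-- Adding h(X_t) - h(X_0) to the centred sum of these products gives a
-- martingale with bounded increments; hence the variance of the sum grows at
-- most linearly and Chebyshev's inequality applies, whatever the initial state.
--
-- Operations on ℝ act termwise.  For each large k the k-th terms of the weights
-- form a rational probability measure; all estimates are made for fixed k in ℚ,
-- with bounds uniform in k.

open import Defs hiding (_+_; _*_; -_; _-_)
open import Algebra.Bundles using (CommutativeRing)
open import Data.Bool.Base using (Bool; true; false; if_then_else_)
open import Data.Bool.Properties using () renaming (_≟_ to _≟ᵇ_)
open import Data.Fin.Base using (Fin; zero; suc; toℕ; fromℕ<; inject₁)
open import Data.Fin.Properties using (toℕ-fromℕ<; toℕ-injective; toℕ-inject₁) renaming (_≟_ to _≟ᶠ_)
open import Data.Integer.Base as ℤ using (+_; -[1+_]; +≤+; -≤+)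
import Data.Integer.Properties as ℤ
open import Data.List.Base as List using (List; []; _∷_; _++_; length; filter; allFin)
open import Data.Nat.Base as ℕ using (ℕ; zero; suc; _≤_; z≤n; s≤s)
import Data.Nat.Properties as ℕ
import Data.Nat.Solver as ℕ
open import Data.Product.Base using (_×_; _,_; proj₁; proj₂; map₂; ∃-syntax)
open import Data.Rational.Base as ℚ
  using (ℚ; mkℚ; 0ℚ; 1ℚ; ½; _+_; _*_; -_; _-_; ∣_∣; nonNegative; positive; toℚᵘ)
  renaming (_≤_ to _≤ℚ_; _<_ to _<ℚ_)
import Data.Rational.Properties as ℚ
open import Data.Rational.Solver using (module +-*-Solver)
open import Data.Rational.Unnormalised.Base as ℚᵘ using (mkℚᵘ; *≡*; *≤*; _≃_)
import Data.Rational.Unnormalised.Properties as ℚᵘ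
open import Data.Sum.Base using (_⊎_; inj₁; inj₂)
open import Data.Vec.Base as Vec using (Vec; []; _∷_; lookup)
open import Data.Vec.Properties using (lookup∘tabulate)
open import Level using (0ℓ)
open import Relation.Binary.Definitions using (tri<; tri≈; tri>)
open import Relation.Binary.PropositionalEquality
open import Relation.Nullary using (Dec; does; yes; no; ¬_; ¬?; contradiction)
open import Relation.Nullary.Decidable using (map′; _×-dec_)
open import Relation.Unary using (Pred; Decidable)
open import Algebra.Properties.Semiring.Sum (CommutativeRing.semiring ℚ.+-*-commutativeRing)
  using (sum; sum-cong-≗)
open import Algebra.Properties.Semiring.Mult (CommutativeRing.semiring ℚ.+-*-commutativeRing)
  using (×1-homo-*; ×-homo-+) renaming (_×_ to _×ₙ_)
open +-*-Solver using (solve; _:+_; _:*_; _:-_; :-_; _:=_; con)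

private
  variable
    A B : Set

-- Rational arithmetic

2ℚ 4ℚ : ℚ
2ℚ = 1ℚ + 1ℚ
4ℚ = 2ℚ * 2ℚ

-- Iterated addition of `1ℚ`, so that `⟦ suc n ⟧` unfolds to `1ℚ + ⟦ n ⟧`; inductions and solver
-- calls rely on this.
⟦_⟧ : ℕ → ℚ
⟦ n ⟧ = n ×ₙ 1ℚ

toℚᵘ-⟦⟧ : ∀ n → toℚᵘ ⟦ n ⟧ ≃ mkℚᵘ (+ n) 0
toℚᵘ-⟦⟧ zero    = *≡* refl
toℚᵘ-⟦⟧ (suc n) = ℚᵘ.≃-trans (ℚ.toℚᵘ-homo-+ 1ℚ ⟦ n ⟧)
  (ℚᵘ.≃-trans (ℚᵘ.+-congʳ (toℚᵘ 1ℚ) (toℚᵘ-⟦⟧ n)) (*≡* (cong (λ i → i ℤ.* + 1) (cong (λ i → + 1 ℤ.+ i) (ℤ.*-identityʳ (+ n))))))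

/-*-cancel : ∀ k m → (+ k ℚ./ suc m) * ⟦ suc m ⟧ ≡ ⟦ k ⟧
/-*-cancel k m = ℚ.toℚᵘ-injective (begin
  toℚᵘ ((+ k ℚ./ suc m) * ⟦ suc m ⟧)            ≈⟨ ℚ.toℚᵘ-homo-* (+ k ℚ./ suc m) ⟦ suc m ⟧ ⟩
  toℚᵘ (+ k ℚ./ suc m) ℚᵘ.* toℚᵘ ⟦ suc m ⟧     ≈⟨ ℚᵘ.*-cong (ℚ.toℚᵘ-fromℚᵘ (mkℚᵘ (+ k) m)) (toℚᵘ-⟦⟧ (suc m)) ⟩
  mkℚᵘ (+ k) m ℚᵘ.* mkℚᵘ (+ suc m) 0            ≈⟨ *≡* (ℤ.*-assoc (+ k) (+ suc m) (+ 1)) ⟩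
  mkℚᵘ (+ k) 0                                  ≈⟨ toℚᵘ-⟦⟧ k ⟨
  toℚᵘ ⟦ k ⟧                                    ∎)
  where open ℚᵘ.≃-Reasoning

0≤⟦_⟧ : ∀ n → 0ℚ ≤ℚ ⟦ n ⟧
0≤⟦ zero  ⟧ = ℚ.≤-refl
0≤⟦ suc n ⟧ = ℚ.+-mono-≤ (ℚ.nonNegative⁻¹ 1ℚ) 0≤⟦ n ⟧

≤-by : ∀ {p q} d → 0ℚ ≤ℚ d → p + d ≡ q → p ≤ℚ q
≤-by {p} d 0≤d eq = subst₂ _≤ℚ_ (ℚ.+-identityʳ p) eq (ℚ.+-monoʳ-≤ p 0≤d)

p≤q⇒0≤q-p : ∀ {p q} → p ≤ℚ q → 0ℚ ≤ℚ q - p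
p≤q⇒0≤q-p {p} {q} p≤q = subst (_≤ℚ q - p) (ℚ.+-inverseʳ p) (ℚ.+-monoˡ-≤ (- p) p≤q)

0≤* : ∀ {p q} → 0ℚ ≤ℚ p → 0ℚ ≤ℚ q → 0ℚ ≤ℚ p * q
0≤* {p} {q} 0≤p 0≤q = ℚ.nonNegative⁻¹ (p * q)
  {{ℚ.nonNeg*nonNeg⇒nonNeg p {{nonNegative 0≤p}} q {{nonNegative 0≤q}}}}

0<* : ∀ {p q} → 0ℚ <ℚ p → 0ℚ <ℚ q → 0ℚ <ℚ p * q
0<* {p} {q} 0<p 0<q = ℚ.positive⁻¹ (p * q) {{ℚ.pos*pos⇒pos p {{positive 0<p}} q {{positive 0<q}}}}

*-monoʳ : ∀ {p q} c → 0ℚ ≤ℚ c → p ≤ℚ q → c * p ≤ℚ c * q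
*-monoʳ c 0≤c = ℚ.*-monoˡ-≤-nonNeg c {{nonNegative 0≤c}}

*-mono : ∀ {p q r s} → 0ℚ ≤ℚ p → 0ℚ ≤ℚ r → p ≤ℚ q → r ≤ℚ s → p * r ≤ℚ q * s
*-mono {p} {q} {r} {s} 0≤p 0≤r p≤q r≤s = ℚ.≤-trans (*-monoʳ p 0≤p r≤s)
  (ℚ.*-monoʳ-≤-nonNeg s {{nonNegative (ℚ.≤-trans 0≤r r≤s)}} p≤q)

0≤square : ∀ p → 0ℚ ≤ℚ p * p
0≤square p with ℚ.≤-total 0ℚ p
... | inj₁ 0≤p = 0≤* 0≤p 0≤p
... | inj₂ p≤0 = subst (0ℚ ≤ℚ_) (solve 1 (λ p → :- p :* :- p := p :* p) refl p)
                   (0≤* (ℚ.neg-antimono-≤ p≤0) (ℚ.neg-antimono-≤ p≤0))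

listSum : (A → ℚ) → List A → ℚ
listSum f = List.foldr (λ x s → f x + s) 0ℚ

listSum-mono : ∀ (xs : List A) {f g} → (∀ x → f x ≤ℚ g x) → listSum f xs ≤ℚ listSum g xs
listSum-mono []       f≤g = ℚ.≤-refl
listSum-mono (x ∷ xs) f≤g = ℚ.+-mono-≤ (f≤g x) (listSum-mono xs f≤g)

listSum-1 : ∀ (xs : List A) → listSum (λ _ → 1ℚ) xs ≡ ⟦ length xs ⟧
listSum-1 []       = refl
listSum-1 (x ∷ xs) = cong (λ s → 1ℚ + s) (listSum-1 xs)

1/n*n : ∀ n .{{_ : ℕ.NonZero n}} → (+ 1 ℚ./ n) * ⟦ n ⟧ ≡ 1ℚ
1/n*n (suc n) = /-*-cancel 1 n

0≤1/n : ∀ n .{{_ : ℕ.NonZero n}} → 0ℚ ≤ℚ (+ 1 ℚ./ n)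
0≤1/n n = ℚ.nonNegative⁻¹ (+ 1 ℚ./ n) {{ℚ.normalize-nonNeg 1 n}}

-- Expectations with respect to the k-th terms of the weights
𝔼 : ℕ → Dist A → (A → ℚ) → ℚ
𝔼 k []            f = 0ℚ
𝔼 k ((p , x) ∷ μ) f = seq p k * f x + 𝔼 k μ f

module _ (k : ℕ) where

  𝔼-cong : ∀ (μ : Dist A) {f g} → f ≗ g → 𝔼 k μ f ≡ 𝔼 k μ g
  𝔼-cong []            f≗g = refl
  𝔼-cong ((p , x) ∷ μ) f≗g = cong₂ (λ y z → seq p k * y + z) (f≗g x) (𝔼-cong μ f≗g)

  𝔼-+ : ∀ (μ : Dist A) f g → 𝔼 k μ (λ x → f x + g x) ≡ 𝔼 k μ f + 𝔼 k μ g
  𝔼-+ []            f g = refl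
  𝔼-+ ((p , x) ∷ μ) f g = trans (cong (λ s → (seq p k * (f x + g x)) + s) (𝔼-+ μ f g))
    (solve 5 (λ p a b c d → p :* (a :+ b) :+ (c :+ d) := (p :* a :+ c) :+ (p :* b :+ d)) refl
      (seq p k) (f x) (g x) (𝔼 k μ f) (𝔼 k μ g))

  𝔼-* : ∀ (μ : Dist A) c f → 𝔼 k μ (λ x → c * f x) ≡ c * 𝔼 k μ f
  𝔼-* []            c f = sym (ℚ.*-zeroʳ c)
  𝔼-* ((p , x) ∷ μ) c f = trans (cong (λ s → (seq p k * (c * f x)) + s) (𝔼-* μ c f))
    (solve 4 (λ p c a b → p :* (c :* a) :+ c :* b := c :* (p :* a :+ b)) refl
      (seq p k) c (f x) (𝔼 k μ f))

  𝔼-++ : ∀ (μ ν : Dist A) f → 𝔼 k (μ ++ ν) f ≡ 𝔼 k μ f + 𝔼 k ν f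
  𝔼-++ []            ν f = sym (ℚ.+-identityˡ (𝔼 k ν f))
  𝔼-++ ((p , x) ∷ μ) ν f = trans (cong (λ s → (seq p k * f x) + s) (𝔼-++ μ ν f))
    (sym (ℚ.+-assoc (seq p k * f x) (𝔼 k μ f) (𝔼 k ν f)))

  𝔼-map : ∀ (g : A → B) μ f → 𝔼 k (List.map (map₂ g) μ) f ≡ 𝔼 k μ (λ x → f (g x))
  𝔼-map g []            f = refl
  𝔼-map g ((p , x) ∷ μ) f = cong (λ s → (seq p k * f (g x)) + s) (𝔼-map g μ f)

  𝔼-⊗ : ∀ (μ : Dist A) (ν : Dist B) f →
         𝔼 k (μ ⊗ ν) f ≡ 𝔼 k μ (λ x → 𝔼 k ν (λ y → f (x , y)))
  𝔼-⊗ []            ν f = refl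
  𝔼-⊗ ((p , x) ∷ μ) ν f = trans (𝔼-++ (List.map _ ν) (μ ⊗ ν) f) (cong₂ _+_ (scaled ν) (𝔼-⊗ μ ν f))
    where
    scaled : ∀ ν → 𝔼 k (List.map (λ y → p Defs.* proj₁ y , (x , proj₂ y)) ν) f ≡
                   seq p k * 𝔼 k ν (λ y → f (x , y))
    scaled []            = sym (ℚ.*-zeroʳ (seq p k))
    scaled ((q , y) ∷ ν) = trans (cong₂ _+_ (ℚ.*-assoc (seq p k) (seq q k) (f (x , y))) (scaled ν))
      (sym (ℚ.*-distribˡ-+ (seq p k) (seq q k * f (x , y)) (𝔼 k ν (λ y → f (x , y)))))

  𝔼-bern : ∀ p f → 𝔼 k (bern p) f ≡ seq p k * f true + (1ℚ - seq p k) * f false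
  𝔼-bern p f = cong (λ s → (seq p k * f true) + s) (ℚ.+-identityʳ _)

  𝔼-⨂ : ∀ {n} (μ : Fin (suc n) → Dist A) f →
         𝔼 k (⨂ μ) f ≡ 𝔼 k (μ zero) (λ x → 𝔼 k (⨂ (λ i → μ (suc i))) (λ xs → f (x ∷ xs)))
  𝔼-⨂ μ f = trans (𝔼-map _ (μ zero ⊗ ⨂ (λ i → μ (suc i))) f) (𝔼-⊗ (μ zero) _ _)

  𝔼-uniform : ∀ (xs : List A) .{{_ : ℕ.NonZero (length xs)}} f →
              𝔼 k (uniform xs) f ≡ (+ 1 ℚ./ length xs) * listSum f xs
  𝔼-uniform xs f = weighted (+ 1 ℚ./ length xs) xs
    where
    weighted : ∀ w ys → 𝔼 k (List.map (λ x → fromℚ w , x) ys) f ≡ w * listSum f ys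
    weighted w []       = sym (ℚ.*-zeroʳ w)
    weighted w (y ∷ ys) = trans (cong (λ s → (w * f y) + s) (weighted w ys)) (sym (ℚ.*-distribˡ-+ w (f y) (listSum f ys)))

  ℙ≡𝔼 : ∀ {E : Pred A 0ℓ} (E? : Decidable E) μ →
        seq (ℙ[ E? ] μ) k ≡ 𝔼 k μ (λ x → if does (E? x) then 1ℚ else 0ℚ)
  ℙ≡𝔼 E? []            = refl
  ℙ≡𝔼 E? ((p , x) ∷ μ) with does (E? x)
  ... | true  = cong₂ _+_ (sym (ℚ.*-identityʳ (seq p k))) (ℙ≡𝔼 E? μ)
  ... | false = cong₂ _+_ (sym (ℚ.*-zeroʳ (seq p k))) (ℙ≡𝔼 E? μ)

  -- Nonnegativity of the weights is encoded as monotonicity of the expectation: this form passes to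
  -- images and products by composing inequalities, and it is the form in which pointwise bounds are
  -- integrated later.
  record IsProbability (μ : Dist A) : Set where
    field
      mono : ∀ {f g} → (∀ x → f x ≤ℚ g x) → 𝔼 k μ f ≤ℚ 𝔼 k μ g
      mass : 𝔼 k μ (λ _ → 1ℚ) ≡ 1ℚ

    const : ∀ c → 𝔼 k μ (λ _ → c) ≡ c
    const c = begin
      𝔼 k μ (λ _ → c)          ≡⟨ 𝔼-cong μ (λ _ → sym (ℚ.*-identityʳ c)) ⟩
      𝔼 k μ (λ _ → c * 1ℚ)     ≡⟨ 𝔼-* μ c (λ _ → 1ℚ) ⟩
      c * 𝔼 k μ (λ _ → 1ℚ)     ≡⟨ cong (c *_) mass ⟩
      c * 1ℚ                   ≡⟨ ℚ.*-identityʳ c ⟩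
      c                        ∎
      where open ≡-Reasoning

    affine : ∀ c d f → 𝔼 k μ (λ x → c + d * f x) ≡ c + d * 𝔼 k μ f
    affine c d f = trans (𝔼-+ μ (λ _ → c) (λ x → d * f x)) (cong₂ _+_ (const c) (𝔼-* μ d f))

  open IsProbability public

  map-prob : ∀ (g : A → B) {μ} → IsProbability μ → IsProbability (List.map (map₂ g) μ)
  map-prob g {μ} P = record
    { mono = λ {f} {h} f≤h → subst₂ _≤ℚ_ (sym (𝔼-map g μ f)) (sym (𝔼-map g μ h)) (mono P (λ x → f≤h (g x)))
    ; mass = trans (𝔼-map g μ _) (mass P)
    }

  ⊗-prob : ∀ {μ : Dist A} {ν : Dist B} → IsProbability μ → IsProbability ν → IsProbability (μ ⊗ ν)
  ⊗-prob {μ = μ} {ν} P Q = record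
    { mono = λ {f} {h} f≤h → subst₂ _≤ℚ_ (sym (𝔼-⊗ μ ν f)) (sym (𝔼-⊗ μ ν h)) (mono P (λ x → mono Q (λ y → f≤h (x , y))))
    ; mass = trans (𝔼-⊗ μ ν _) (trans (𝔼-cong μ (λ _ → mass Q)) (mass P))
    }

  ⨂-prob : ∀ {n} {μ : Fin n → Dist A} → (∀ i → IsProbability (μ i)) → IsProbability (⨂ μ)
  ⨂-prob {n = zero} P = record
    { mono = λ f≤h → ℚ.+-monoˡ-≤ 0ℚ (*-monoʳ 1ℚ (ℚ.nonNegative⁻¹ 1ℚ) (f≤h []))
    ; mass = refl
    }
  ⨂-prob {n = suc n} P = map-prob _ (⊗-prob (P zero) (⨂-prob (λ i → P (suc i))))

  bern-prob : ∀ {p} → 0ℚ ≤ℚ seq p k → seq p k ≤ℚ 1ℚ → IsProbability (bern p)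
  bern-prob {p} 0≤p p≤1 = record
    { mono = λ {f} {h} f≤h → subst₂ _≤ℚ_ (sym (𝔼-bern p f)) (sym (𝔼-bern p h))
        (ℚ.+-mono-≤ (*-monoʳ (seq p k) 0≤p (f≤h true)) (*-monoʳ (1ℚ - seq p k) (p≤q⇒0≤q-p p≤1) (f≤h false)))
    ; mass = trans (𝔼-bern p (λ _ → 1ℚ)) (solve 1 (λ x → x :* con 1ℚ :+ (con 1ℚ :- x) :* con 1ℚ
         := con 1ℚ) refl (seq p k))
    }

  uniform-prob : ∀ (xs : List A) .{{_ : ℕ.NonZero (length xs)}} → IsProbability (uniform xs)
  uniform-prob xs = record
    { mono = λ {f} {h} f≤h → subst₂ _≤ℚ_ (sym (𝔼-uniform xs f)) (sym (𝔼-uniform xs h))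
        (*-monoʳ (+ 1 ℚ./ length xs) (0≤1/n (length xs)) (listSum-mono xs f≤h))
    ; mass = trans (𝔼-uniform xs _) (trans (cong ((+ 1 ℚ./ length xs) *_) (listSum-1 xs)) (1/n*n (length xs)))
    }

-- Moments of sums of independent variables

total : (A → ℚ) → ∀ {n} → Vec A n → ℚ
total f xs = sum (λ i → f (lookup xs i))

module _ (k : ℕ) {A : Set} (f : A → ℚ) where

  mean : ∀ {n} {μ : Fin n → Dist A} → (∀ i → IsProbability k (μ i)) → Fin n → ℚ
  mean {μ = μ} P i = 𝔼 k (μ i) f

  𝔼-lookup : ∀ {n} {μ : Fin n → Dist A} (P : ∀ i → IsProbability k (μ i)) i →
             𝔼 k (⨂ μ) (λ xs → f (lookup xs i)) ≡ 𝔼 k (μ i) f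
  𝔼-lookup {μ = μ} P zero = trans (𝔼-⨂ k μ _)
    (𝔼-cong k (μ zero) (λ x → const (⨂-prob k (λ i → P (suc i))) (f x)))
  𝔼-lookup {μ = μ} P (suc i) = trans (𝔼-⨂ k μ _)
    (trans (𝔼-cong k (μ zero) (λ _ → 𝔼-lookup (λ j → P (suc j)) i)) (const (P zero) _))

  𝔼-total : ∀ {n} {μ : Fin n → Dist A} (P : ∀ i → IsProbability k (μ i)) →
            𝔼 k (⨂ μ) (total f) ≡ sum (mean P)
  𝔼-total {zero}      P = refl
  𝔼-total {suc n} {μ} P = begin
    𝔼 k (⨂ μ) (total f)                              ≡⟨ 𝔼-⨂ k μ (total f) ⟩
    𝔼 k (μ zero) (λ x → 𝔼 k ν (λ xs → f x + total f xs))
      ≡⟨ 𝔼-cong k (μ zero) (λ x → trans (𝔼-+ k ν (λ _ → f x) (total f)) (cong₂ _+_ (const Q (f x)) (𝔼-total P′))) ⟩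
    𝔼 k (μ zero) (λ x → f x + sum (mean P′))        ≡⟨ 𝔼-+ k (μ zero) f (λ _ → sum (mean P′)) ⟩
    𝔼 k (μ zero) f + 𝔼 k (μ zero) (λ _ → sum (mean P′)) ≡⟨ cong (λ s → 𝔼 k (μ zero) f + s) (const (P zero) _) ⟩
    sum (mean P)                                    ∎
    where
    open ≡-Reasoning
    ν = ⨂ (λ i → μ (suc i))
    P′ = λ i → P (suc i)
    Q = ⨂-prob k P′

  module _ (f² : ∀ x → f x * f x ≡ 1ℚ) where

    -- The diagonal term is the mean of `f * f`, which is 1; by independence every other coordinate
    -- contributes a product of two means.
    𝔼-lookup*total : ∀ {n} {μ : Fin n → Dist A} (P : ∀ i → IsProbability k (μ i)) i →
      𝔼 k (⨂ μ) (λ xs → f (lookup xs i) * total f xs) ≡ 1ℚ + mean P i * (sum (mean P) - mean P i)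
    𝔼-lookup*total {μ = μ} P zero = begin
      𝔼 k (⨂ μ) (λ xs → f (lookup xs zero) * total f xs)                ≡⟨ 𝔼-⨂ k μ _ ⟩
      𝔼 k (μ zero) (λ x → 𝔼 k ν (λ xs → f x * (f x + total f xs)))
        ≡⟨ 𝔼-cong k (μ zero) (λ x →
             𝔼-cong k ν (λ xs → trans (ℚ.*-distribˡ-+ (f x) (f x) (total f xs)) (cong (λ s → s + f x * total f xs) (f² x)))) ⟩
      𝔼 k (μ zero) (λ x → 𝔼 k ν (λ xs → 1ℚ + f x * total f xs))
        ≡⟨ 𝔼-cong k (μ zero) (λ x →
             trans (affine Q 1ℚ (f x) (total f)) (cong (λ s → 1ℚ + s) (trans (cong (f x *_) (𝔼-total P′)) (ℚ.*-comm (f x) M)))) ⟩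
      𝔼 k (μ zero) (λ x → 1ℚ + M * f x)                               ≡⟨ affine (P zero) 1ℚ M f ⟩
      1ℚ + M * m                                                       ≡⟨ solve 2 (λ m M → con 1ℚ :+ M :* m
           := con 1ℚ :+ m :* (m :+ M :- m)) refl m M ⟩
      1ℚ + m * (m + M - m)                                             ∎
      where
      open ≡-Reasoning
      ν = ⨂ (λ i → μ (suc i))
      P′ = λ i → P (suc i)
      Q = ⨂-prob k P′
      m = mean P zero
      M = sum (mean P′)
    𝔼-lookup*total {μ = μ} P (suc i) = begin
      𝔼 k (⨂ μ) (λ xs → f (lookup xs (suc i)) * total f xs)             ≡⟨ 𝔼-⨂ k μ _ ⟩
      𝔼 k (μ zero) (λ x → 𝔼 k ν (λ xs → f (lookup xs i) * (f x + total f xs)))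
        ≡⟨ 𝔼-cong k (μ zero) (λ x →
             𝔼-cong k ν (λ xs → trans (ℚ.*-distribˡ-+ (f (lookup xs i)) (f x) (total f xs))
               (cong (λ s → s + f (lookup xs i) * total f xs) (ℚ.*-comm _ (f x))))) ⟩
      𝔼 k (μ zero) (λ x → 𝔼 k ν (λ xs → f x * f (lookup xs i) + f (lookup xs i) * total f xs))
        ≡⟨ 𝔼-cong k (μ zero) (λ x →
             trans (𝔼-+ k ν _ _) (cong₂ _+_ (trans (𝔼-* k ν (f x) _) (cong (f x *_) (𝔼-lookup P′ i))) (𝔼-lookup*total P′ i))) ⟩
      𝔼 k (μ zero) (λ x → f x * mᵢ + (1ℚ + mᵢ * (M - mᵢ)))
        ≡⟨ 𝔼-cong k (μ zero) (λ x →
             trans (ℚ.+-comm (f x * mᵢ) _) (cong (λ s → 1ℚ + mᵢ * (M - mᵢ) + s) (ℚ.*-comm (f x) mᵢ))) ⟩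
      𝔼 k (μ zero) (λ x → 1ℚ + mᵢ * (M - mᵢ) + mᵢ * f x)               ≡⟨ affine (P zero) (1ℚ + mᵢ * (M - mᵢ)) mᵢ f ⟩
      1ℚ + mᵢ * (M - mᵢ) + mᵢ * m
        ≡⟨ solve 3 (λ m M mᵢ → con 1ℚ :+ mᵢ :* (M :- mᵢ) :+ mᵢ :* m := con 1ℚ :+ mᵢ :* (m :+ M :- mᵢ)) refl m M mᵢ ⟩
      1ℚ + mᵢ * (m + M - mᵢ)                                           ∎
      where
      open ≡-Reasoning
      ν = ⨂ (λ i → μ (suc i))
      P′ = λ i → P (suc i)
      m = mean P zero
      mᵢ = mean P (suc i)
      M = sum (mean P′)

    -- In the expanded square the `n` diagonal terms give 1 each. The off-diagonal terms are
    -- products of means at distinct indices, that is, the square of the sum of means less the sum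
    -- of their squares.
    𝔼-total² : ∀ {n} {μ : Fin n → Dist A} (P : ∀ i → IsProbability k (μ i)) →
      𝔼 k (⨂ μ) (λ xs → total f xs * total f xs) ≡
      ⟦ n ⟧ + (sum (mean P) * sum (mean P) - sum (λ i → mean P i * mean P i))
    𝔼-total² {zero}      P = refl
    𝔼-total² {suc n} {μ} P = begin
      𝔼 k (⨂ μ) (λ xs → total f xs * total f xs)                          ≡⟨ 𝔼-⨂ k μ _ ⟩
      𝔼 k (μ zero) (λ x → 𝔼 k ν (λ xs → (f x + total f xs) * (f x + total f xs)))
        ≡⟨ 𝔼-cong k (μ zero) (λ x →
             𝔼-cong k ν (λ xs → trans (expand (f x) (total f xs))
               (cong (λ s → s + (f x + f x) * total f xs + total f xs * total f xs) (f² x)))) ⟩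
      𝔼 k (μ zero) (λ x → 𝔼 k ν (λ xs → 1ℚ + (f x + f x) * total f xs + total f xs * total f xs))
        ≡⟨ 𝔼-cong k (μ zero) (λ x →
             trans (𝔼-+ k ν _ _) (cong₂ _+_
               (trans (affine Q 1ℚ (f x + f x) (total f)) (cong (λ s → 1ℚ + (f x + f x) * s) (𝔼-total P′)))
               (𝔼-total² P′))) ⟩
      𝔼 k (μ zero) (λ x → 1ℚ + (f x + f x) * M + (⟦ n ⟧ + (M * M - V)))
        ≡⟨ 𝔼-cong k (μ zero) (λ x → solve 4 (λ y M c V → con 1ℚ :+ (y :+ y) :* M :+ (c :+ (M :* M :- V))
             := con 1ℚ :+ (c :+ (M :* M :- V)) :+ (M :+ M) :* y) refl (f x) M ⟦ n ⟧ V) ⟩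
      𝔼 k (μ zero) (λ x → 1ℚ + (⟦ n ⟧ + (M * M - V)) + (M + M) * f x)
        ≡⟨ affine (P zero) (1ℚ + (⟦ n ⟧ + (M * M - V))) (M + M) f ⟩
      1ℚ + (⟦ n ⟧ + (M * M - V)) + (M + M) * m
        ≡⟨ solve 4 (λ m M c V → con 1ℚ :+ (c :+ (M :* M :- V)) :+ (M :+ M) :* m
             := con 1ℚ :+ c :+ ((m :+ M) :* (m :+ M) :- (m :* m :+ V))) refl m M ⟦ n ⟧ V ⟩
      ⟦ suc n ⟧ + ((m + M) * (m + M) - (m * m + V))                    ∎
      where
      open ≡-Reasoning
      ν = ⨂ (λ i → μ (suc i))
      P′ = λ i → P (suc i)
      Q = ⨂-prob k P′
      m = mean P zero
      M = sum (mean P′)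
      V = sum (λ i → mean P′ i * mean P′ i)
      expand : ∀ y z → (y + z) * (y + z) ≡ y * y + (y + y) * z + z * z
      expand = solve 2 (λ y z → (y :+ z) :* (y :+ z) := y :* y :+ (y :+ y) :* z :+ z :* z) refl

-- Sums over the neighbours of a vertex of Kₙ

listSum-filter : ∀ {P : Pred A 0ℓ} (P? : Decidable P) (f : A → ℚ) xs →
  listSum f (filter P? xs) ≡ listSum (λ x → if does (P? x) then f x else 0ℚ) xs
listSum-filter P? f [] = refl
listSum-filter P? f (x ∷ xs) with does (P? x)
... | true  = cong (λ s → f x + s) (listSum-filter P? f xs)
... | false = trans (listSum-filter P? f xs) (sym (ℚ.+-identityˡ _))

listSum-tabulate : ∀ {n} (f : A → ℚ) (g : Fin n → A) → listSum f (List.tabulate g) ≡ sum (λ i → f (g i))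
listSum-tabulate {n = zero}  f g = refl
listSum-tabulate {n = suc n} f g = cong (λ s → f (g zero) + s) (listSum-tabulate f (λ i → g (suc i)))

sum-remove-self : ∀ {n} (f : Fin n → ℚ) u →
  sum (λ v → if does (¬? (u ≟ᶠ v)) then f v else 0ℚ) ≡ sum f - f u
sum-remove-self f zero = solve 2 (λ x s → con 0ℚ :+ s := x :+ s :- x) refl (f zero) (sum (λ v → f (suc v)))
sum-remove-self f (suc u) = trans (cong (λ s → f zero + s) (sum-remove-self (λ v → f (suc v)) u))
  (sym (ℚ.+-assoc (f zero) (sum (λ v → f (suc v))) (- f (suc u))))

listSum-neighbours : ∀ {n} (2≤n : 2 ≤ n) (f : Fin n → ℚ) u →
  listSum f (Graph.neighbours (K n 2≤n) u) ≡ sum f - f u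
listSum-neighbours {n} 2≤n f u = trans (listSum-filter (λ v → ¬? (u ≟ᶠ v)) f (allFin n))
  (trans (listSum-tabulate {n = n} (λ v → if does (¬? (u ≟ᶠ v)) then f v else 0ℚ) (λ v → v)) (sum-remove-self f u))

-- The Poisson equation

-- For μ = 1/(n-1), the probability that two given vertices of Kₙ choose the same neighbour.
coalesce : ℚ → ℚ
coalesce μ = μ - μ * μ

-- The stationary correlation E[σ_t(u) σ_{t+1}(u)] is num / den.  The Poisson
-- equation is multiplied by den * res, which clears all denominators.
module _ (a μ : ℚ) where

  -- With `s` the spin at the observed vertex and `n * μ = 1 + μ`, the transition operator is
  -- triangular on the span of 1, S² and sS: S² goes to (1 - `den`) S² plus a constant, and sS to (1
  -- - `res`) sS + a² (μ - μ²) S² plus a constant. Hence `β` balances the source `den * res * a * μ`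
  -- times sS, and `α` then cancels the S² term that `β` creates.
  den num res α β : ℚ
  den = 1ℚ - a * a + a * a * coalesce μ
  num = a * a * a * coalesce μ
  res = 1ℚ + a * a * μ - (a * a * (μ * μ) + a * a * (μ * μ))
  α   = a * a * a * μ * coalesce μ
  β   = den * a * μ

  drift-identity : ∀ n s S → n * μ ≡ 1ℚ + μ → s * s ≡ 1ℚ →
    den * res * (a * μ * (s * S - 1ℚ)) - res * num
    + (α * (n + a * a * S * S - a * a * μ * μ * ((n - 2ℚ) * S * S + n)) +
       β * (1ℚ + a * μ * (S - s) * (a * S - a * μ * (S - s))))
    - (α * (S * S) + β * (s * S)) ≡ 0ℚ
  drift-identity n s S nμ ss = trans
    -- The hypotheses enter through explicit cofactors: the left side equals a multiple of
    -- `n * μ - (1 + μ)` plus a multiple of `s * s - 1`, and both factors vanish.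
    (solve 5 (λ a μ n s S →
        let one = con 1ℚ
            o = μ :- μ :* μ
            D = one :- a :* a :+ a :* a :* o
            N = a :* a :* a :* o
            R = one :+ a :* a :* μ :- (a :* a :* (μ :* μ) :+ a :* a :* (μ :* μ))
            α = a :* a :* a :* μ :* o
            β = D :* a :* μ in
        D :* R :* (a :* μ :* (s :* S :- one)) :- R :* N
        :+ (α :* (n :+ a :* a :* S :* S :- a :* a :* μ :* μ :* ((n :- con 2ℚ) :* S :* S :+ n)) :+
            β :* (one :+ a :* μ :* (S :- s) :* (a :* S :- a :* μ :* (S :- s))))
        :- (α :* (S :* S) :+ β :* (s :* S))
        :=
        N :* ((n :* μ) :- (one :+ μ)) :* (one :- a :* a :* μ :* μ :- a :* a :* μ :* μ :* S :* S)
        :- β :* a :* a :* μ :* μ :* (s :* s :- one))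
      refl a μ n s S)
    (trans (cong₂ (λ x y → num * (x - (1ℚ + μ)) * (1ℚ - a * a * μ * μ - a * a * μ * μ * S * S) - β * a * a * μ * μ * (y - 1ℚ)) nμ ss)
      (solve 4 (λ μ x y z → x :* (con 1ℚ :+ μ :- (con 1ℚ :+ μ)) :* y :- z :* (con 1ℚ :- con 1ℚ) := con 0ℚ) refl
        μ num (1ℚ - a * a * μ * μ - a * a * μ * μ * S * S) (β * a * a * μ * μ)))

-- Absolute values and coefficients in the unit interval

∣p∣≤q⇒p²≤q² : ∀ {p q} → ∣ p ∣ ≤ℚ q → p * p ≤ℚ q * q
∣p∣≤q⇒p²≤q² {p} ∣p∣≤q = ℚ.≤-trans (ℚ.≤-reflexive (trans (sym (ℚ.0≤p⇒∣p∣≡p (0≤square p))) (ℚ.∣p*q∣≡∣p∣*∣q∣ p p)))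
  (*-mono (ℚ.0≤∣p∣ p) (ℚ.0≤∣p∣ p) ∣p∣≤q ∣p∣≤q)

∣+∣≤ : ∀ {p q r s} → ∣ p ∣ ≤ℚ r → ∣ q ∣ ≤ℚ s → ∣ p + q ∣ ≤ℚ r + s
∣+∣≤ {p} {q} p≤r q≤s = ℚ.≤-trans (ℚ.∣p+q∣≤∣p∣+∣q∣ p q) (ℚ.+-mono-≤ p≤r q≤s)

∣-∣≤ : ∀ {p q r s} → ∣ p ∣ ≤ℚ r → ∣ q ∣ ≤ℚ s → ∣ p - q ∣ ≤ℚ r + s
∣-∣≤ {p} {q} p≤r q≤s = ℚ.≤-trans (ℚ.∣p-q∣≤∣p∣+∣q∣ p q) (ℚ.+-mono-≤ p≤r q≤s)

∣*∣≤ : ∀ {p q r s} → ∣ p ∣ ≤ℚ r → ∣ q ∣ ≤ℚ s → ∣ p * q ∣ ≤ℚ r * s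
∣*∣≤ {p} {q} p≤r q≤s = ℚ.≤-trans (ℚ.≤-reflexive (ℚ.∣p*q∣≡∣p∣*∣q∣ p q)) (*-mono (ℚ.0≤∣p∣ p) (ℚ.0≤∣p∣ q) p≤r q≤s)

0≤p≤q⇒∣p∣≤q : ∀ {p q} → 0ℚ ≤ℚ p → p ≤ℚ q → ∣ p ∣ ≤ℚ q
0≤p≤q⇒∣p∣≤q 0≤p p≤q = subst (_≤ℚ _) (sym (ℚ.0≤p⇒∣p∣≡p 0≤p)) p≤q

∣sum∣≤ : ∀ {n} (f : Fin n → ℚ) → (∀ i → ∣ f i ∣ ≤ℚ 1ℚ) → ∣ sum f ∣ ≤ℚ ⟦ n ⟧
∣sum∣≤ {zero}  f f≤1 = ℚ.≤-refl
∣sum∣≤ {suc n} f f≤1 = ∣+∣≤ (f≤1 zero) (∣sum∣≤ (λ i → f (suc i)) (λ i → f≤1 (suc i)))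

record Unit (p : ℚ) : Set where
  constructor unit
  field
    0≤ : 0ℚ ≤ℚ p
    ≤1 : p ≤ℚ 1ℚ

open Unit public

_⊛_ : ∀ {p q} → Unit p → Unit q → Unit (p * q)
unit 0≤p p≤1 ⊛ unit 0≤q q≤1 = unit (0≤* 0≤p 0≤q) (*-mono 0≤p 0≤q p≤1 q≤1)

co : ∀ {p} → Unit p → Unit (1ℚ - p)
co {p} (unit 0≤p p≤1) = unit (p≤q⇒0≤q-p p≤1) (≤-by p 0≤p (solve 1 (λ p → con 1ℚ :- p :+ p := con 1ℚ) refl p))

coalesce∈ : ∀ {μ} → Unit μ → Unit (coalesce μ)
coalesce∈ {μ} μ∈ = subst Unit (solve 1 (λ m → m :* (con 1ℚ :- m) := m :- m :* m) refl μ) (μ∈ ⊛ co μ∈)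

module _ {a μ : ℚ} (a∈ : Unit a) (μ∈ : Unit μ) where

  den∈ : Unit (den a μ)
  den∈ = subst Unit (solve 2 (λ a o → con 1ℚ :- a :* a :* (con 1ℚ :- o)
       := con 1ℚ :- a :* a :+ a :* a :* o) refl a (coalesce μ))
    (co ((a∈ ⊛ a∈) ⊛ co (coalesce∈ μ∈)))

  num∈ : Unit (num a μ)
  num∈ = ((a∈ ⊛ a∈) ⊛ a∈) ⊛ coalesce∈ μ∈

  α∈ : Unit (α a μ)
  α∈ = (((a∈ ⊛ a∈) ⊛ a∈) ⊛ μ∈) ⊛ coalesce∈ μ∈

  β∈ : Unit (β a μ)
  β∈ = (den∈ ⊛ a∈) ⊛ μ∈

  -- The surplus factors as a² (1 - μ)(1 + 2μ). This bounds `res` from below independently of `μ`.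
  1-a²≤res : 1ℚ - a * a ≤ℚ res a μ
  1-a²≤res = ≤-by (a * a * ((1ℚ - μ) * (1ℚ + (μ + μ))))
    (0≤* (0≤* (0≤ a∈) (0≤ a∈)) (0≤* (0≤ (co μ∈)) (ℚ.+-mono-≤ (ℚ.nonNegative⁻¹ 1ℚ) (ℚ.+-mono-≤ (0≤ μ∈) (0≤ μ∈)))))
    (solve 2 (λ a m → con 1ℚ :- a :* a :+ a :* a :* ((con 1ℚ :- m) :* (con 1ℚ :+ (m :+ m)))
      := con 1ℚ :+ a :* a :* m :- (a :* a :* (m :* m) :+ a :* a :* (m :* m))) refl a μ)

  0≤res : 0ℚ ≤ℚ res a μ
  0≤res = ℚ.≤-trans (0≤ (co (a∈ ⊛ a∈))) 1-a²≤res

  res≤2 : res a μ ≤ℚ 2ℚ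
  res≤2 = ≤-by (1ℚ - a * a * μ + (a * a * (μ * μ) + a * a * (μ * μ)))
    (ℚ.+-mono-≤ (0≤ (co ((a∈ ⊛ a∈) ⊛ μ∈))) (ℚ.+-mono-≤ (0≤ ((a∈ ⊛ a∈) ⊛ (μ∈ ⊛ μ∈))) (0≤ ((a∈ ⊛ a∈) ⊛ (μ∈ ⊛ μ∈)))))
    (solve 2 (λ x y → con 1ℚ :+ x :- (y :+ y) :+ (con 1ℚ :- x :+ (y :+ y))
         := con 2ℚ) refl (a * a * μ) (a * a * (μ * μ)))

∣unit∣≤1 : ∀ {p} → Unit p → ∣ p ∣ ≤ℚ 1ℚ
∣unit∣≤1 (unit 0≤p p≤1) = 0≤p≤q⇒∣p∣≤q 0≤p p≤1

-- Spins, uniform bounds and rational averages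

spin : Bool → ℚ
spin true  = 1ℚ
spin false = - 1ℚ

spin² : ∀ b → spin b * spin b ≡ 1ℚ
spin² true  = refl
spin² false = refl

∣spin∣≤1 : ∀ b → ∣ spin b ∣ ≤ℚ 1ℚ
∣spin∣≤1 true  = ℚ.≤-refl
∣spin∣≤1 false = ℚ.≤-refl

sum-affine : ∀ {n} (f : Fin n → ℚ) c d → sum (λ i → c + d * f i) ≡ ⟦ n ⟧ * c + d * sum f
sum-affine {zero}  f c d = solve 2 (λ c d → con 0ℚ := con 0ℚ :* c :+ d :* con 0ℚ) refl c d
sum-affine {suc n} f c d = trans (cong (λ s → c + d * f zero + s) (sum-affine (λ i → f (suc i)) c d))
  (solve 5 (λ c d n x s → c :+ d :* x :+ (n :* c :+ d :* s) := (con 1ℚ :+ n) :* c :+ d :* (x :+ s)) refl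
    c d ⟦ n ⟧ (f zero) (sum (λ i → f (suc i))))

sum-1 : ∀ n → sum {n} (λ _ → 1ℚ) ≡ ⟦ n ⟧
sum-1 zero    = refl
sum-1 (suc n) = cong (λ s → 1ℚ + s) (sum-1 n)

-- Identifies the weight 1/degree, which comes from the length of a filtered list, with the `μ` that
-- is known only through `n * μ ≡ 1ℚ + μ`.
inverse-unique : ∀ w l n μ → w * l ≡ 1ℚ → l ≡ n - 1ℚ → n * μ ≡ 1ℚ + μ → w ≡ μ
inverse-unique w l n μ wl l≡ nμ = begin
  w                          ≡⟨ solve 2 (λ w m → w := w :* (con 1ℚ :+ m) :- w :* m) refl w μ ⟩
  w * (1ℚ + μ) - w * μ       ≡⟨ cong (λ x → w * x - w * μ) nμ ⟨
  w * (n * μ) - w * μ        ≡⟨ solve 3 (λ w n m → w :* (n :* m) :- w :* m := w :* (n :- con 1ℚ) :* m) refl w n μ ⟩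
  w * (n - 1ℚ) * μ           ≡⟨ cong (λ x → w * x * μ) l≡ ⟨
  w * l * μ                  ≡⟨ cong (_* μ) wl ⟩
  1ℚ * μ                     ≡⟨ ℚ.*-identityˡ μ ⟩
  μ                          ∎
  where open ≡-Reasoning

½∈ : Unit ½
½∈ = unit (ℚ.nonNegative⁻¹ ½) (≤-by ½ (ℚ.nonNegative⁻¹ ½) refl)

-- Both depend on `n` alone, hence are uniform in the index `k`. The first uses that |S| is at most
-- `n` and `α`, `β` at most 1; in the second, the two terms of the centred product are at most 2
-- each, since `res` is at most 2.
potentialBound gainBound : ℕ → ℚ
potentialBound n = ⟦ n ⟧ * ⟦ n ⟧ + ⟦ n ⟧
gainBound n = 4ℚ + (potentialBound n + potentialBound n)

[p+q]²≤2p²+2q² : ∀ p q → (p + q) * (p + q) ≤ℚ 2ℚ * (p * p) + 2ℚ * (q * q)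
[p+q]²≤2p²+2q² p q = ≤-by ((p - q) * (p - q)) (0≤square (p - q))
  (solve 2 (λ p q → (p :+ q) :* (p :+ q) :+ (p :- q) :* (p :- q) := con 2ℚ :* (p :* p) :+ con 2ℚ :* (q :* q)) refl p q)

averageℚ : ∀ {m} → (Fin m → Bool) → ℚ
averageℚ {zero}  r = 0ℚ
averageℚ {suc m} r = + Vec.sum (Vec.tabulate λ i → if r i then 1 else 0) ℚ./ suc m

average≡averageℚ : ∀ {m} (r : Fin m → Bool) → average r ≡ fromℚ (averageℚ r)
average≡averageℚ {zero}  r = refl
average≡averageℚ {suc m} r = refl

⟦count⟧ : ∀ {m} (r : Fin m → Bool) → let c = ⟦ Vec.sum (Vec.tabulate λ i → if r i then 1 else 0) ⟧ in
          c + c - ⟦ m ⟧ ≡ sum (λ i → spin (r i))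
⟦count⟧ {zero}  r = refl
⟦count⟧ {suc m} r with r zero
... | true  = trans
  (solve 2 (λ c m → con 1ℚ :+ c :+ (con 1ℚ :+ c) :- (con 1ℚ :+ m) := con 1ℚ :+ (c :+ c :- m)) refl
    ⟦ Vec.sum (Vec.tabulate λ i → if r (suc i) then 1 else 0) ⟧ ⟦ m ⟧)
  (cong (λ s → 1ℚ + s) (⟦count⟧ (λ i → r (suc i))))
... | false = trans
  (solve 2 (λ c m → c :+ c :- (con 1ℚ :+ m) := con (- 1ℚ) :+ (c :+ c :- m)) refl
    ⟦ Vec.sum (Vec.tabulate λ i → if r (suc i) then 1 else 0) ⟧ ⟦ m ⟧)
  (cong (λ s → - 1ℚ + s) (⟦count⟧ (λ i → r (suc i))))

-- An indicator average q corresponds to the mean spin 2q - 1. The equation is multiplied by `m`, so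
-- it also covers the empty average.
averageℚ-spin : ∀ {m} (r : Fin m → Bool) → (averageℚ r + averageℚ r - 1ℚ) * ⟦ m ⟧ ≡ sum (λ i → spin (r i))
averageℚ-spin {zero}  r = refl
averageℚ-spin {suc m} r = trans (double (averageℚ r) ⟦ suc m ⟧)
  (trans (cong (λ c → c + c - ⟦ suc m ⟧) (/-*-cancel (Vec.sum (Vec.tabulate λ i → if r i then 1 else 0)) m)) (⟦count⟧ r))
  where
  double : ∀ x y → (x + x - 1ℚ) * y ≡ x * y + x * y - y
  double = solve 2 (λ x y → (x :+ x :- con 1ℚ) :* y := x :* y :+ x :* y :- y) refl

spin-≟ : ∀ b c → spin (does (b ≟ᵇ c)) ≡ spin b * spin c
spin-≟ true  true  = refl
spin-≟ true  false = refl
spin-≟ false true  = refl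
spin-≟ false false = refl

reciprocal : ∀ {p} → 0ℚ <ℚ p → ∃[ w ] 0ℚ ≤ℚ w × w * p ≡ 1ℚ
reciprocal {p} 0<p = (ℚ.1/ p) {{p≢0}} ,
  ℚ.<⇒≤ (ℚ.positive⁻¹ ((ℚ.1/ p) {{p≢0}}) {{ℚ.1/pos⇒pos p {{positive 0<p}}}}) ,
  ℚ.*-inverseˡ p {{p≢0}}
  where
  p≢0 = ℚ.pos⇒nonZero p {{positive 0<p}}

-- Markov's inequality for φ bounds the probability that Good fails by δ.
record FailureBound (k : ℕ) {Ω : Set} (μ : Dist Ω) (Good : Ω → Set) (δ : ℚ) : Set where
  field
    isProbability : IsProbability k μ
    φ             : Ω → ℚ
    0≤φ           : ∀ ω → 0ℚ ≤ℚ φ ω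
    1≤φ           : ∀ ω → ¬ Good ω → 1ℚ ≤ℚ φ ω
    𝔼φ≤δ          : 𝔼 k μ φ ≤ℚ δ

open FailureBound public

-- The process on a complete graph

-- The equation `nμ` says that μ = 1/(n-1), the probability of copying a given neighbour, in the
-- form consumed by `drift-identity`.
module CompleteGraph (k : ℕ) (ε : ℝ) (ε∈ : Unit (seq ε k)) {n} (2≤n : 2 ≤ n) (u : Fin n)
                     (μ : ℚ) (nμ : ⟦ n ⟧ * μ ≡ 1ℚ + μ) (μ∈ : Unit μ) where

  open NVM ε (K n 2≤n)
  open Graph (K n 2≤n) using (neighbours; degree≢0)

  a : ℚ
  a = 1ℚ - seq ε k

  a∈ : Unit a
  a∈ = co ε∈

  siteLaw-prob : ∀ v → IsProbability k (siteLaw v)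
  siteLaw-prob v = map-prob k (λ (ξ , Y , η) → site ξ Y η)
    (⊗-prob k (bern-prob k {p = ε} (0≤ ε∈) (≤1 ε∈))
      (⊗-prob k (bern-prob k {p = fromℚ ½} (0≤ ½∈) (≤1 ½∈))
                (uniform-prob k (neighbours v) {{degree≢0 v}})))

  stepLaw : Dist (Vec Site n)
  stepLaw = ⨂ siteLaw

  stepLaw-prob : IsProbability k stepLaw
  stepLaw-prob = ⨂-prob k siteLaw-prob

  σ : State → ℚ
  σ x = spin (lookup x u)

  outcome : State → Site → ℚ
  outcome x s = spin (if Site.ξ s then Site.Y s else lookup x (Site.η s))

  σ-step : ∀ x ν → σ (step ν x) ≡ outcome x (lookup ν u)
  σ-step x ν = cong spin (lookup∘tabulate _ u)

  total-step : ∀ x ν → total spin (step ν x) ≡ total (outcome x) ν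
  total-step x ν = sum-cong-≗ {n} (λ v → cong spin (lookup∘tabulate next v))
    where
    next : Fin n → Bool
    next w = if Site.ξ (lookup ν w) then Site.Y (lookup ν w) else lookup x (Site.η (lookup ν w))

  1/degree≡μ : ∀ v → (+ 1 ℚ./ length (neighbours v)) {{degree≢0 v}} ≡ μ
  1/degree≡μ v = inverse-unique _ _ ⟦ n ⟧ μ (1/n*n (length (neighbours v)) {{degree≢0 v}}) degree nμ
    where
    degree : ⟦ length (neighbours v) ⟧ ≡ ⟦ n ⟧ - 1ℚ
    degree = trans (sym (listSum-1 (neighbours v)))
      (trans (listSum-neighbours 2≤n (λ _ → 1ℚ) v) (cong (λ s → s - 1ℚ) (sum-1 n)))

  -- The noise spin has mean zero. With probability `a` the vertex copies, and a uniform neighbour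
  -- has mean spin `μ` times the sum over all other vertices.
  𝔼-outcome : ∀ x v → 𝔼 k (siteLaw v) (outcome x) ≡ a * μ * (total spin x - spin (lookup x v))
  𝔼-outcome x v = begin
    𝔼 k (siteLaw v) (outcome x)     ≡⟨ 𝔼-map k _ (bern ε ⊗ noise ⊗ choice) (outcome x) ⟩
    𝔼 k (bern ε ⊗ noise ⊗ choice) F  ≡⟨ 𝔼-⊗ k (bern ε) (noise ⊗ choice) F ⟩
    𝔼 k (bern ε) (λ ξ → 𝔼 k (noise ⊗ choice) (λ y → F (ξ , y)))
      ≡⟨ 𝔼-cong k (bern ε) (λ ξ → trans (𝔼-⊗ k noise choice (λ y → F (ξ , y))) (𝔼-bern k (fromℚ ½) (E ξ))) ⟩
    𝔼 k (bern ε) (λ ξ → ½ * E ξ true + (1ℚ - ½) * E ξ false)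
      ≡⟨ 𝔼-bern k ε (λ ξ → ½ * E ξ true + (1ℚ - ½) * E ξ false) ⟩
    seq ε k * (½ * E true true + (1ℚ - ½) * E true false) + a * (½ * E false true + (1ℚ - ½) * E false false)
      ≡⟨ cong₂ (λ y z → seq ε k * y + a * z)
           (cong₂ (λ y z → ½ * y + (1ℚ - ½) * z) (const choice-prob 1ℚ) (const choice-prob (- 1ℚ)))
           (cong (λ y → ½ * y + (1ℚ - ½) * y) copied) ⟩
    seq ε k * (½ * 1ℚ + (1ℚ - ½) * (- 1ℚ)) + a * (½ * (μ * m) + (1ℚ - ½) * (μ * m))
      ≡⟨ solve 4 (λ e a w m → e :* (con ½ :* con 1ℚ :+ (con 1ℚ :- con ½) :* (con (- 1ℚ)))
             :+ a :* (con ½ :* (w :* m) :+ (con 1ℚ :- con ½) :* (w :* m))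
           := a :* w :* m) refl (seq ε k) a μ m ⟩
    a * μ * m                        ∎
    where
    open ≡-Reasoning
    m = total spin x - spin (lookup x v)
    noise = bern (fromℚ ½)
    choice = uniform (neighbours v) {{degree≢0 v}}
    choice-prob = uniform-prob k (neighbours v) {{degree≢0 v}}
    F : Bool × Bool × Fin n → ℚ
    F (ξ , Y , η) = outcome x (site ξ Y η)
    E : Bool → Bool → ℚ
    E ξ Y = 𝔼 k choice (λ η → F (ξ , Y , η))
    copied : 𝔼 k choice (λ η → spin (lookup x η)) ≡ μ * m
    copied = trans (𝔼-uniform k (neighbours v) {{degree≢0 v}} (λ η → spin (lookup x η)))
      (cong₂ _*_ (1/degree≡μ v) (listSum-neighbours 2≤n (λ η → spin (lookup x η)) v))

  module _ (x : State) where

    private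
      S : ℚ
      S = total spin x

    -- Every spin is seen by the `n - 1` other vertices, each with weight `a * μ`, and (n - 1) μ =
    -- 1.
    sum-mean : sum (mean k (outcome x) siteLaw-prob) ≡ a * S
    sum-mean = begin
      sum (mean k (outcome x) siteLaw-prob)
        ≡⟨ sum-cong-≗ (λ v → trans (𝔼-outcome x v) (solve 3 (λ c S y → c :* (S :- y)
             := c :* S :+ (:- c) :* y) refl (a * μ) S (spin (lookup x v)))) ⟩
      sum (λ v → a * μ * S + - (a * μ) * spin (lookup x v))
        ≡⟨ sum-affine (λ v → spin (lookup x v)) (a * μ * S) (- (a * μ)) ⟩
      ⟦ n ⟧ * (a * μ * S) + - (a * μ) * S
        ≡⟨ solve 4 (λ n a m S → n :* (a :* m :* S) :+ (:- (a :* m)) :* S := a :* S :* (n :* m :- m)) refl ⟦ n ⟧ a μ S ⟩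
      a * S * (⟦ n ⟧ * μ - μ)            ≡⟨ cong (λ y → a * S * (y - μ)) nμ ⟩
      a * S * (1ℚ + μ - μ)               ≡⟨ solve 2 (λ y m → y :* (con 1ℚ :+ m :- m) := y) refl (a * S) μ ⟩
      a * S                              ∎
      where open ≡-Reasoning

    -- Sum of (S - y)² over all spins y, expanded with y² = 1: it is nS² - 2S² + n.
    sum-mean² : sum (λ v → mean k (outcome x) siteLaw-prob v * mean k (outcome x) siteLaw-prob v) ≡
                a * a * μ * μ * ((⟦ n ⟧ - 2ℚ) * S * S + ⟦ n ⟧)
    sum-mean² = begin
      sum (λ v → mean k (outcome x) siteLaw-prob v * mean k (outcome x) siteLaw-prob v)
        ≡⟨ sum-cong-≗ square ⟩
      sum (λ v → c * c * (S * S + 1ℚ) + - (c * c * (S + S)) * spin (lookup x v))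
        ≡⟨ sum-affine (λ v → spin (lookup x v)) (c * c * (S * S + 1ℚ)) (- (c * c * (S + S))) ⟩
      ⟦ n ⟧ * (c * c * (S * S + 1ℚ)) + - (c * c * (S + S)) * S
        ≡⟨ solve 4 (λ n a m S → let c = a :* m in n :* (c :* c :* (S :* S :+ con 1ℚ)) :+ (:- (c :* c :* (S :+ S))) :* S
             := a :* a :* m :* m :* ((n :- con 2ℚ) :* S :* S :+ n)) refl ⟦ n ⟧ a μ S ⟩
      a * a * μ * μ * ((⟦ n ⟧ - 2ℚ) * S * S + ⟦ n ⟧)  ∎
      where
      open ≡-Reasoning
      c = a * μ
      square : ∀ v → mean k (outcome x) siteLaw-prob v * mean k (outcome x) siteLaw-prob v ≡
               c * c * (S * S + 1ℚ) + - (c * c * (S + S)) * spin (lookup x v)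
      square v = begin
        mean k (outcome x) siteLaw-prob v * mean k (outcome x) siteLaw-prob v
          ≡⟨ cong₂ _*_ (𝔼-outcome x v) (𝔼-outcome x v) ⟩
        c * (S - y) * (c * (S - y))
          ≡⟨ solve 3 (λ c S y → c :* (S :- y) :* (c :* (S :- y))
               := c :* c :* (S :* S :+ y :* y) :+ (:- (c :* c :* (S :+ S))) :* y) refl c S y ⟩
        c * c * (S * S + y * y) + - (c * c * (S + S)) * y
          ≡⟨ cong (λ z → c * c * (S * S + z) + - (c * c * (S + S)) * y) (spin² (lookup x v)) ⟩
        c * c * (S * S + 1ℚ) + - (c * c * (S + S)) * y  ∎
        where y = spin (lookup x v)

  κ : ℚ
  κ = den a μ * res a μ

  potential : State → ℚ
  potential x = α a μ * (total spin x * total spin x) + β a μ * (σ x * total spin x)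

  -- One martingale increment: the product of consecutive spins minus `num / den`, multiplied by `κ`
  -- (hence the constant `res * num`), plus the change of the potential.
  gain : State → State → ℚ
  gain x y = κ * (σ x * σ y) - res a μ * num a μ + (potential y - potential x)

  -- Given `x` the next spins are independent, so the mean of the next spin at `u`, of the squared
  -- next total and of their product are the moments computed above. After s (S - s) is rewritten as
  -- sS - 1, what remains is the left side of `drift-identity`.
  𝔼-gain : ∀ x → 𝔼 k stepLaw (λ ν → gain x (step ν x)) ≡ 0ℚ
  𝔼-gain x = begin
    𝔼 k stepLaw (λ ν → gain x (step ν x))   ≡⟨ 𝔼-cong k stepLaw regroup ⟩
    𝔼 k stepLaw (λ ν → c + κ * s * f ν + (α a μ * (T ν * T ν) + β a μ * (f ν * T ν)))
      ≡⟨ 𝔼-+ k stepLaw (λ ν → c + κ * s * f ν) (λ ν → α a μ * (T ν * T ν) + β a μ * (f ν * T ν)) ⟩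
    𝔼 k stepLaw (λ ν → c + κ * s * f ν) + 𝔼 k stepLaw (λ ν → α a μ * (T ν * T ν) + β a μ * (f ν * T ν))
      ≡⟨ cong₂ _+_ (affine stepLaw-prob c (κ * s) f)
           (trans (𝔼-+ k stepLaw (λ ν → α a μ * (T ν * T ν)) (λ ν → β a μ * (f ν * T ν)))
             (cong₂ _+_ (𝔼-* k stepLaw (α a μ) (λ ν → T ν * T ν)) (𝔼-* k stepLaw (β a μ) (λ ν → f ν * T ν)))) ⟩
    c + κ * s * 𝔼 k stepLaw f + (α a μ * 𝔼 k stepLaw (λ ν → T ν * T ν) + β a μ * 𝔼 k stepLaw (λ ν → f ν * T ν))
      ≡⟨ cong₂ (λ y z → c + κ * s * y + z) mean-f
           (cong₂ (λ y z → α a μ * y + β a μ * z) mean-TT mean-fT) ⟩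
    c + κ * s * (a * μ * (S - s)) + (α a μ * TT + β a μ * fT)
      ≡⟨ cong (λ y → y + (α a μ * TT + β a μ * fT)) inner ⟩
    κ * (a * μ * (s * S - 1ℚ)) - res a μ * num a μ - (α a μ * (S * S) + β a μ * (s * S)) + (α a μ * TT + β a μ * fT)
      ≡⟨ solve 3 (λ y z w → y :- z :+ w
           := y :+ w :- z) refl (κ * (a * μ * (s * S - 1ℚ)) - res a μ * num a μ) (potential x) (α a μ * TT + β a μ * fT) ⟩
    κ * (a * μ * (s * S - 1ℚ)) - res a μ * num a μ + (α a μ * TT + β a μ * fT) - (α a μ * (S * S) + β a μ * (s * S))
      ≡⟨ drift-identity a μ ⟦ n ⟧ s S nμ (spin² (lookup x u)) ⟩
    0ℚ ∎
    where
    open ≡-Reasoning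
    s = σ x
    S = total spin x
    c = - (res a μ * num a μ) - potential x
    f T : Vec Site n → ℚ
    f ν = outcome x (lookup ν u)
    T ν = total (outcome x) ν
    V = a * a * μ * μ * ((⟦ n ⟧ - 2ℚ) * S * S + ⟦ n ⟧)
    TT = ⟦ n ⟧ + a * a * S * S - V
    fT = 1ℚ + a * μ * (S - s) * (a * S - a * μ * (S - s))
    o² : ∀ z → outcome x z * outcome x z ≡ 1ℚ
    o² z = spin² (if Site.ξ z then Site.Y z else lookup x (Site.η z))
    mean-f : 𝔼 k stepLaw f ≡ a * μ * (S - s)
    mean-f = trans (𝔼-lookup k (outcome x) siteLaw-prob u) (𝔼-outcome x u)
    mean-TT : 𝔼 k stepLaw (λ ν → T ν * T ν) ≡ TT
    mean-TT = trans (𝔼-total² k (outcome x) o² siteLaw-prob)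
      (trans (cong₂ (λ y z → ⟦ n ⟧ + (y * y - z)) (sum-mean x) (sum-mean² x))
        (solve 4 (λ n a S V → n :+ (a :* S :* (a :* S) :- V) := n :+ a :* a :* S :* S :- V) refl ⟦ n ⟧ a S V))
    mean-fT : 𝔼 k stepLaw (λ ν → f ν * T ν) ≡ fT
    mean-fT = trans (𝔼-lookup*total k (outcome x) o² siteLaw-prob u)
      (cong₂ (λ y z → 1ℚ + y * (z - y)) (𝔼-outcome x u) (sum-mean x))
    regroup : ∀ ν → gain x (step ν x) ≡ c + κ * s * f ν + (α a μ * (T ν * T ν) + β a μ * (f ν * T ν))
    regroup ν = trans
      (cong₂ (λ y z → κ * (s * y) - res a μ * num a μ + (α a μ * (z * z) + β a μ * (y * z) - potential x)) (σ-step x ν) (total-step x ν))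
      (solve 6 (λ κ s y r h w → κ :* (s :* y) :- r :+ (w :- h) := (:- r) :- h :+ κ :* s :* y :+ w) refl
        κ s (f ν) (res a μ * num a μ) (potential x) (α a μ * (T ν * T ν) + β a μ * (f ν * T ν)))
    inner : c + κ * s * (a * μ * (S - s)) ≡
            κ * (a * μ * (s * S - 1ℚ)) - res a μ * num a μ - (α a μ * (S * S) + β a μ * (s * S))
    inner = trans
      (solve 6 (λ r h κ s S y → (:- r) :- h :+ κ :* s :* (y :* (S :- s))
           := κ :* (y :* (s :* S :- s :* s)) :- r :- h) refl
        (res a μ * num a μ) (potential x) κ s S (a * μ))
      (cong (λ y → κ * (a * μ * (s * S - y)) - res a μ * num a μ - potential x) (spin² (lookup x u)))

  -- Bounds on the potential and the gain

  ∣potential∣≤ : ∀ x → ∣ potential x ∣ ≤ℚ potentialBound n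
  ∣potential∣≤ x = subst (∣ potential x ∣ ≤ℚ_) (solve 1 (λ n → con 1ℚ :* (n :* n) :+ con 1ℚ :* (con 1ℚ :* n)
       := n :* n :+ n) refl ⟦ n ⟧)
    (∣+∣≤ (∣*∣≤ (∣unit∣≤1 (α∈ a∈ μ∈)) (∣*∣≤ S≤ S≤)) (∣*∣≤ (∣unit∣≤1 (β∈ a∈ μ∈)) (∣*∣≤ (∣spin∣≤1 (lookup x u)) S≤)))
    where
    S≤ : ∣ total spin x ∣ ≤ℚ ⟦ n ⟧
    S≤ = ∣sum∣≤ (λ v → spin (lookup x v)) (λ v → ∣spin∣≤1 (lookup x v))

  ∣Δpotential∣≤ : ∀ x y → ∣ potential y - potential x ∣ ≤ℚ potentialBound n + potentialBound n
  ∣Δpotential∣≤ x y = ∣-∣≤ (∣potential∣≤ y) (∣potential∣≤ x)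

  ∣gain∣≤ : ∀ x y → ∣ gain x y ∣ ≤ℚ gainBound n
  ∣gain∣≤ x y = ∣+∣≤ (∣-∣≤
      (∣*∣≤ {r = 1ℚ * 2ℚ} {1ℚ * 1ℚ} (∣*∣≤ (∣unit∣≤1 (den∈ a∈ μ∈)) res≤) (∣*∣≤ (∣spin∣≤1 (lookup x u)) (∣spin∣≤1 (lookup y u))))
      (∣*∣≤ {r = 2ℚ} {1ℚ} res≤ (∣unit∣≤1 (num∈ a∈ μ∈))))
    (∣Δpotential∣≤ x y)
    where
    res≤ : ∣ res a μ ∣ ≤ℚ 2ℚ
    res≤ = 0≤p≤q⇒∣p∣≤q (0≤res a∈ μ∈) (res≤2 a∈ μ∈)

  gain²≤ : ∀ x y → gain x y * gain x y ≤ℚ gainBound n * gainBound n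
  gain²≤ x y = ∣p∣≤q⇒p²≤q² (∣gain∣≤ x y)

  Δpotential²≤ : ∀ x y → (potential y - potential x) * (potential y - potential x) ≤ℚ gainBound n * gainBound n
  Δpotential²≤ x y = ∣p∣≤q⇒p²≤q² (ℚ.≤-trans (∣Δpotential∣≤ x y)
    (≤-by 4ℚ (ℚ.nonNegative⁻¹ 4ℚ) (ℚ.+-comm (potentialBound n + potentialBound n) 4ℚ)))

  -- The martingale and its second moment

  correlation : ∀ {t} → State → Vec (Vec Site n) t → ℚ
  correlation x []       = 0ℚ
  correlation x (ν ∷ νs) = σ x * σ (step ν x) + correlation (step ν x) νs

  final : ∀ {t} → State → Vec (Vec Site n) t → State
  final x []       = x
  final x (ν ∷ νs) = final (step ν x) νs

  deviation : ∀ {t} → State → Vec (Vec Site n) t → ℚ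
  deviation {t} x νs = κ * correlation x νs - res a μ * num a μ * ⟦ t ⟧

  martingale : ∀ {t} → State → Vec (Vec Site n) t → ℚ
  martingale x νs = deviation x νs + (potential (final x νs) - potential x)

  stepsLaw : ∀ t → Dist (Vec (Vec Site n) t)
  stepsLaw t = ⨂ (λ _ → stepLaw)

  stepsLaw-prob : ∀ t → IsProbability k (stepsLaw t)
  stepsLaw-prob t = ⨂-prob k (λ _ → stepLaw-prob)

  -- Conditioning on the first step, the cross term vanishes because the gain is centred.
  𝔼-martingale² : ∀ t x c → 𝔼 k (stepsLaw t) (λ νs → (c + martingale x νs) * (c + martingale x νs))
                            ≤ℚ c * c + ⟦ t ⟧ * (gainBound n * gainBound n)
  𝔼-martingale² zero x c = ℚ.≤-reflexive
    (solve 5 (λ c κ r h b → let s = c :+ (κ :* con 0ℚ :- r :* con 0ℚ :+ (h :- h))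
        in con 1ℚ :* (s :* s) :+ con 0ℚ := c :* c :+ con 0ℚ :* b) refl
      c κ (res a μ * num a μ) (potential x) (gainBound n * gainBound n))
  𝔼-martingale² (suc t) x c = begin
    𝔼 k (stepsLaw (suc t)) (λ νs → (c + martingale x νs) * (c + martingale x νs))
      ≡⟨ 𝔼-⨂ k (λ _ → stepLaw) (λ νs → (c + martingale x νs) * (c + martingale x νs)) ⟩
    𝔼 k stepLaw (λ ν → 𝔼 k (stepsLaw t) (λ νs → (c + martingale x (ν ∷ νs)) * (c + martingale x (ν ∷ νs))))
      ≡⟨ 𝔼-cong k stepLaw (λ ν → 𝔼-cong k (stepsLaw t) (λ νs → cong (λ z → z * z) (unfold ν νs))) ⟩
    𝔼 k stepLaw (λ ν → 𝔼 k (stepsLaw t) (λ νs → (c + g ν + martingale (step ν x) νs) * (c + g ν + martingale (step ν x) νs)))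
      -- The induction hypothesis is used with `c + g ν` in place of `c`: the constant carries the
      -- gains already made.
      ≤⟨ mono stepLaw-prob (λ ν → 𝔼-martingale² t (step ν x) (c + g ν)) ⟩
    𝔼 k stepLaw (λ ν → (c + g ν) * (c + g ν) + ⟦ t ⟧ * G²)
      ≤⟨ mono stepLaw-prob (λ ν → ≤-by (G² - g ν * g ν) (p≤q⇒0≤q-p (gain²≤ x (step ν x)))
           (solve 4 (λ c g b t → (c :+ g) :* (c :+ g) :+ t :* b :+ (b :- g :* g)
                := c :* c :+ (con 1ℚ :+ t) :* b :+ (c :+ c) :* g) refl c (g ν) G² ⟦ t ⟧)) ⟩
    𝔼 k stepLaw (λ ν → c * c + ⟦ suc t ⟧ * G² + (c + c) * g ν)
      ≡⟨ affine stepLaw-prob (c * c + ⟦ suc t ⟧ * G²) (c + c) g ⟩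
    c * c + ⟦ suc t ⟧ * G² + (c + c) * 𝔼 k stepLaw g
      ≡⟨ cong (λ z → c * c + ⟦ suc t ⟧ * G² + (c + c) * z) (𝔼-gain x) ⟩
    c * c + ⟦ suc t ⟧ * G² + (c + c) * 0ℚ
      ≡⟨ solve 2 (λ y z → y :+ z :* con 0ℚ := y) refl (c * c + ⟦ suc t ⟧ * G²) (c + c) ⟩
    c * c + ⟦ suc t ⟧ * G²  ∎
    where
    open ℚ.≤-Reasoning
    G² = gainBound n * gainBound n
    g : Vec Site n → ℚ
    g ν = gain x (step ν x)
    unfold : ∀ ν (νs : Vec (Vec Site n) t) → c + martingale x (ν ∷ νs) ≡ c + g ν + martingale (step ν x) νs
    unfold ν νs = solve 9 (λ c κ z w r t hf h h′ →
        c :+ (κ :* (z :+ w) :- r :* (con 1ℚ :+ t) :+ (hf :- h)) :=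
        c :+ (κ :* z :- r :+ (h′ :- h)) :+ (κ :* w :- r :* t :+ (hf :- h′))) refl
      c κ (σ x * σ (step ν x)) (correlation (step ν x) νs) (res a μ * num a μ) ⟦ t ⟧
      (potential (final (step ν x) νs)) (potential x) (potential (step ν x))

  -- The deviation differs from the martingale only by the telescoped potential, which is bounded
  -- whatever `t` is. The martingale accounts for `t` of the `suc t` units, the potential for the
  -- remaining one.
  𝔼-deviation² : ∀ t x → 𝔼 k (stepsLaw t) (λ νs → deviation x νs * deviation x νs)
                         ≤ℚ 2ℚ * ⟦ suc t ⟧ * (gainBound n * gainBound n)
  𝔼-deviation² t x = begin
    𝔼 k (stepsLaw t) (λ νs → deviation x νs * deviation x νs)   ≤⟨ mono (stepsLaw-prob t) split ⟩
    𝔼 k (stepsLaw t) (λ νs → 2ℚ * G² + 2ℚ * ((0ℚ + martingale x νs) * (0ℚ + martingale x νs)))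
      ≡⟨ affine (stepsLaw-prob t) (2ℚ * G²) 2ℚ (λ νs → (0ℚ + martingale x νs) * (0ℚ + martingale x νs)) ⟩
    2ℚ * G² + 2ℚ * 𝔼 k (stepsLaw t) (λ νs → (0ℚ + martingale x νs) * (0ℚ + martingale x νs))
      ≤⟨ ℚ.+-monoʳ-≤ (2ℚ * G²) (*-monoʳ 2ℚ (ℚ.nonNegative⁻¹ 2ℚ) (𝔼-martingale² t x 0ℚ)) ⟩
    2ℚ * G² + 2ℚ * (0ℚ * 0ℚ + ⟦ t ⟧ * G²)
      ≡⟨ solve 2 (λ b t → con 2ℚ :* b :+ con 2ℚ :* (con 0ℚ :* con 0ℚ :+ t :* b)
           := con 2ℚ :* (con 1ℚ :+ t) :* b) refl G² ⟦ t ⟧ ⟩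
    2ℚ * ⟦ suc t ⟧ * G²  ∎
    where
    open ℚ.≤-Reasoning
    G² = gainBound n * gainBound n
    split : ∀ νs → deviation x νs * deviation x νs ≤ℚ 2ℚ * G² + 2ℚ * ((0ℚ + martingale x νs) * (0ℚ + martingale x νs))
    split νs = begin
      -- The splitting is d = -Δ + (d + Δ), where d + Δ is the martingale; the leading `0ℚ` below is
      -- the constant `c` of `𝔼-martingale²`.
      d * d              ≡⟨ solve 2 (λ d p → d :* d := (p :+ (d :- p)) :* (p :+ (d :- p))) refl d (- Δ) ⟩
      (- Δ + (d - - Δ)) * (- Δ + (d - - Δ))   ≤⟨ [p+q]²≤2p²+2q² (- Δ) (d - - Δ) ⟩
      2ℚ * (- Δ * - Δ) + 2ℚ * ((d - - Δ) * (d - - Δ))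
        ≡⟨ solve 2 (λ d p → con 2ℚ :* (:- p :* :- p) :+ con 2ℚ :* ((d :- :- p) :* (d :- :- p))
             := con 2ℚ :* (p :* p) :+ con 2ℚ :* ((con 0ℚ :+ (d :+ p)) :* (con 0ℚ :+ (d :+ p)))) refl d Δ ⟩
      2ℚ * (Δ * Δ) + 2ℚ * ((0ℚ + (d + Δ)) * (0ℚ + (d + Δ)))
        ≤⟨ ℚ.+-monoˡ-≤ (2ℚ * ((0ℚ + (d + Δ)) * (0ℚ + (d + Δ)))) (*-monoʳ 2ℚ (ℚ.nonNegative⁻¹ 2ℚ) (Δpotential²≤ x (final x νs))) ⟩
      2ℚ * G² + 2ℚ * ((0ℚ + (d + Δ)) * (0ℚ + (d + Δ)))  ∎
      where
      d = deviation x νs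
      Δ = potential (final x νs) - potential x

  -- Observations and Chebyshev's inequality

  initial : Dist State
  initial = ⨂ (λ _ → bern (fromℚ ½))

  initial-prob : IsProbability k initial
  initial-prob = ⨂-prob k (λ _ → bern-prob k {p = fromℚ ½} (0≤ ½∈) (≤1 ½∈))

  law-prob : ∀ t → IsProbability k (law t)
  law-prob t = ⊗-prob k initial-prob (stepsLaw-prob t)

  lookup-observe : ∀ {t} x (νs : Vec (Vec Site n) t) → lookup (observe u (x , νs)) zero ≡ lookup x u
  lookup-observe x []       = refl
  lookup-observe x (ν ∷ νs) = refl

  sum-products : ∀ {t} x (νs : Vec (Vec Site n) t) → let Y = observe u (x , νs) in
    sum (λ i → spin (lookup Y (inject₁ i)) * spin (lookup Y (suc i))) ≡ correlation x νs
  sum-products x []       = refl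
  sum-products x (ν ∷ νs) = cong₂ (λ b s → σ x * b + s)
    (cong spin (lookup-observe (step ν x) νs)) (sum-products (step ν x) νs)

  rate : ∀ {t} → Ω t → ℚ
  rate {t} ω = averageℚ (repeats 1 t (observe u ω))

  -- The statistic starts at time 1, so the pair (X₀, X₁) is not counted. With `suc t` steps there
  -- are `t` compared pairs, and they are the consecutive pairs of the process restarted from
  -- `step ν x`.
  rate-correlation : ∀ {t} x ν (νs : Vec (Vec Site n) t) →
    (rate (x , ν ∷ νs) + rate (x , ν ∷ νs) - 1ℚ) * ⟦ t ⟧ ≡ correlation (step ν x) νs
  rate-correlation {t} x ν νs = trans (averageℚ-spin (repeats 1 (suc t) X))
    (trans (sum-cong-≗ {t} pointwise) (sum-products (step ν x) νs))
    where
    X = observe u (x , ν ∷ νs)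
    Y = observe u (step ν x , νs)
    pointwise : ∀ i → spin (repeats 1 (suc t) X i) ≡ spin (lookup Y (inject₁ i)) * spin (lookup Y (suc i))
    pointwise i = trans (spin-≟ (lookup X (fromℕ< p)) (lookup X (fromℕ< q)))
      (cong₂ (λ j j′ → spin (lookup X j) * spin (lookup X j′))
        (toℕ-injective (trans (toℕ-fromℕ< p) (trans (ℕ.+-identityʳ _) (cong suc (sym (toℕ-inject₁ i))))))
        (toℕ-injective (trans (toℕ-fromℕ< q) (ℕ.+-comm (suc (toℕ i)) 1))))
      where
      p = index< (suc t) 1 0 ℕ.z≤n i
      q = index< (suc t) 1 1 ℕ.≤-refl i

  -- The Markov function is the squared deviation divided by (γ (t + 1))². Its mean is bounded for
  -- each fixed state after the first step, and this uniform bound is then averaged over the initial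
  -- state and that step.
  chebyshev : ∀ t {γ δ} (Good : Ω (suc (suc t)) → Set) → 0ℚ <ℚ γ → 0ℚ ≤ℚ δ →
    4ℚ * (gainBound n * gainBound n) ≤ℚ δ * (γ * γ) * ⟦ suc t ⟧ →
    (∀ x ν νs → ¬ Good (x , ν ∷ νs) →
       (γ * ⟦ suc t ⟧) * (γ * ⟦ suc t ⟧) ≤ℚ deviation (step ν x) νs * deviation (step ν x) νs) →
    FailureBound k (law (suc (suc t))) Good δ
  chebyshev t {γ} {δ} Good 0<γ 0≤δ large far = record
    { isProbability = law-prob (suc (suc t))
    ; φ             = ψ
    ; 0≤φ           = λ { (x , ν ∷ νs) → 0≤* 0≤w (0≤square (deviation (step ν x) νs)) }
    ; 1≤φ           = λ { (x , ν ∷ νs) bad → subst (_≤ℚ ψ (x , ν ∷ νs)) w*g² (*-monoʳ w 0≤w (far x ν νs bad)) }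
    ; 𝔼φ≤δ          = expectation
    }
    where
    open ℚ.≤-Reasoning
    G² = gainBound n * gainBound n
    s = ⟦ suc t ⟧
    g = γ * s
    0<g : 0ℚ <ℚ g
    0<g = 0<* 0<γ (ℚ.+-mono-<-≤ (ℚ.positive⁻¹ 1ℚ) 0≤⟦ t ⟧)
    w = proj₁ (reciprocal (0<* 0<g 0<g))
    0≤w = proj₁ (proj₂ (reciprocal (0<* 0<g 0<g)))
    w*g² = proj₂ (proj₂ (reciprocal (0<* 0<g 0<g)))
    ψ : Ω (suc (suc t)) → ℚ
    ψ (x , ν ∷ νs) = w * (deviation (step ν x) νs * deviation (step ν x) νs)
    small : w * (2ℚ * ⟦ suc (suc t) ⟧ * G²) ≤ℚ δ
    small = begin
      w * (2ℚ * ⟦ suc (suc t) ⟧ * G²)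
        -- Since t + 2 is at most 2 (t + 1), the factor 2 becomes the 4 in the hypothesis `large`.
        ≤⟨ *-monoʳ w 0≤w (≤-by (2ℚ * ⟦ t ⟧ * G²) (0≤* (0≤* (ℚ.nonNegative⁻¹ 2ℚ) 0≤⟦ t ⟧) (0≤square (gainBound n)))
             (solve 2 (λ t b → con 2ℚ :* (con 1ℚ :+ (con 1ℚ :+ t)) :* b :+ con 2ℚ :* t :* b
                  := con 4ℚ :* b :* (con 1ℚ :+ t)) refl ⟦ t ⟧ G²)) ⟩
      w * (4ℚ * G² * s)
        ≤⟨ *-monoʳ w 0≤w (ℚ.*-monoʳ-≤-nonNeg s {{nonNegative 0≤⟦ suc t ⟧}} large) ⟩
      w * (δ * (γ * γ) * s * s)
        ≡⟨ solve 4 (λ w d c s → w :* (d :* (c :* c) :* s :* s) := d :* (w :* (c :* s :* (c :* s)))) refl w δ γ s ⟩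
      δ * (w * (g * g))  ≡⟨ cong (δ *_) w*g² ⟩
      δ * 1ℚ             ≡⟨ ℚ.*-identityʳ δ ⟩
      δ                  ∎
    expectation : 𝔼 k (law (suc (suc t))) ψ ≤ℚ δ
    expectation = begin
      𝔼 k (law (suc (suc t))) ψ   ≡⟨ 𝔼-⊗ k initial (stepsLaw (suc (suc t))) ψ ⟩
      𝔼 k initial (λ x → 𝔼 k (stepsLaw (suc (suc t))) (λ νs → ψ (x , νs)))
        ≡⟨ 𝔼-cong k initial (λ x → 𝔼-⨂ k (λ _ → stepLaw) (λ νs → ψ (x , νs))) ⟩
      𝔼 k initial (λ x → 𝔼 k stepLaw (λ ν → 𝔼 k (stepsLaw (suc t)) (λ νs → ψ (x , ν ∷ νs))))
        ≤⟨ mono initial-prob (λ x → mono stepLaw-prob (λ ν → fromState (step ν x))) ⟩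
      𝔼 k initial (λ x → 𝔼 k stepLaw (λ ν → δ))
        ≡⟨ trans (𝔼-cong k initial (λ _ → const stepLaw-prob δ)) (const initial-prob δ) ⟩
      δ  ∎
      where
      fromState : ∀ y → 𝔼 k (stepsLaw (suc t)) (λ νs → w * (deviation y νs * deviation y νs)) ≤ℚ δ
      fromState y = begin
        𝔼 k (stepsLaw (suc t)) (λ νs → w * (deviation y νs * deviation y νs))
          ≡⟨ 𝔼-* k (stepsLaw (suc t)) w (λ νs → deviation y νs * deviation y νs) ⟩
        w * 𝔼 k (stepsLaw (suc t)) (λ νs → deviation y νs * deviation y νs)
          ≤⟨ *-monoʳ w 0≤w (𝔼-deviation² (suc t) y) ⟩
        w * (2ℚ * ⟦ suc (suc t) ⟧ * G²)  ≤⟨ small ⟩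
        δ  ∎

  -- The threshold `θ` lives on the scale of the correlation 2q - 1. If the rate reaches it, the
  -- deviation is at least res (den θ - num) (t + 1), hence at least γ (t + 1).
  below : ∀ t {γ δ θ} → 0ℚ <ℚ γ → 0ℚ ≤ℚ δ →
    4ℚ * (gainBound n * gainBound n) ≤ℚ δ * (γ * γ) * ⟦ suc t ⟧ →
    γ ≤ℚ res a μ * (den a μ * θ - num a μ) →
    FailureBound k (law (suc (suc t))) (λ ω → rate ω + rate ω <ℚ 1ℚ + θ) δ
  below t {γ} {δ} {θ} 0<γ 0≤δ large gap = chebyshev t _ 0<γ 0≤δ large far
    where
    open ℚ.≤-Reasoning
    s = ⟦ suc t ⟧
    far : ∀ x ν νs → ¬ (rate (x , ν ∷ νs) + rate (x , ν ∷ νs) <ℚ 1ℚ + θ) →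
          (γ * s) * (γ * s) ≤ℚ deviation (step ν x) νs * deviation (step ν x) νs
    far x ν νs bad = *-mono (0≤* (ℚ.<⇒≤ 0<γ) 0≤⟦ suc t ⟧) (0≤* (ℚ.<⇒≤ 0<γ) 0≤⟦ suc t ⟧) le le
      where
      r = rate (x , ν ∷ νs)
      θ≤ : θ ≤ℚ r + r - 1ℚ
      θ≤ = subst (_≤ℚ r + r - 1ℚ) (solve 1 (λ θ → con 1ℚ :+ θ :- con 1ℚ := θ) refl θ)
             (ℚ.+-monoˡ-≤ (- 1ℚ) (ℚ.≮⇒≥ bad))
      le : γ * s ≤ℚ deviation (step ν x) νs
      le = begin
        γ * s   ≤⟨ ℚ.*-monoʳ-≤-nonNeg s {{nonNegative 0≤⟦ suc t ⟧}} gap ⟩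
        res a μ * (den a μ * θ - num a μ) * s
          ≡⟨ solve 5 (λ r d θ n s → r :* (d :* θ :- n) :* s
               := d :* r :* (θ :* s) :- r :* n :* s) refl (res a μ) (den a μ) θ (num a μ) s ⟩
        κ * (θ * s) - res a μ * num a μ * s
          ≤⟨ ℚ.+-monoˡ-≤ (- (res a μ * num a μ * s)) (*-monoʳ κ (0≤* (0≤ (den∈ a∈ μ∈)) (0≤res a∈ μ∈))
               (ℚ.*-monoʳ-≤-nonNeg s {{nonNegative 0≤⟦ suc t ⟧}} θ≤)) ⟩
        κ * ((r + r - 1ℚ) * s) - res a μ * num a μ * s
          ≡⟨ cong (λ z → κ * z - res a μ * num a μ * s) (rate-correlation x ν νs) ⟩
        deviation (step ν x) νs  ∎

  -- Mirror image of `below`: on failure the negated deviation is large, and squaring removes the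
  -- sign.
  above : ∀ t {γ δ θ} → 0ℚ <ℚ γ → 0ℚ ≤ℚ δ →
    4ℚ * (gainBound n * gainBound n) ≤ℚ δ * (γ * γ) * ⟦ suc t ⟧ →
    γ ≤ℚ res a μ * (num a μ - den a μ * θ) →
    FailureBound k (law (suc (suc t))) (λ ω → 1ℚ + θ <ℚ rate ω + rate ω) δ
  above t {γ} {δ} {θ} 0<γ 0≤δ large gap = chebyshev t _ 0<γ 0≤δ large far
    where
    open ℚ.≤-Reasoning
    s = ⟦ suc t ⟧
    far : ∀ x ν νs → ¬ (1ℚ + θ <ℚ rate (x , ν ∷ νs) + rate (x , ν ∷ νs)) →
          (γ * s) * (γ * s) ≤ℚ deviation (step ν x) νs * deviation (step ν x) νs
    far x ν νs bad = subst ((γ * s) * (γ * s) ≤ℚ_)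
      (solve 1 (λ d → :- d :* :- d := d :* d) refl (deviation (step ν x) νs))
      (*-mono (0≤* (ℚ.<⇒≤ 0<γ) 0≤⟦ suc t ⟧) (0≤* (ℚ.<⇒≤ 0<γ) 0≤⟦ suc t ⟧) le le)
      where
      r = rate (x , ν ∷ νs)
      ≤θ : r + r - 1ℚ ≤ℚ θ
      ≤θ = subst (r + r - 1ℚ ≤ℚ_) (solve 1 (λ θ → con 1ℚ :+ θ :- con 1ℚ := θ) refl θ)
             (ℚ.+-monoˡ-≤ (- 1ℚ) (ℚ.≮⇒≥ bad))
      le : γ * s ≤ℚ - deviation (step ν x) νs
      le = begin
        γ * s   ≤⟨ ℚ.*-monoʳ-≤-nonNeg s {{nonNegative 0≤⟦ suc t ⟧}} gap ⟩
        res a μ * (num a μ - den a μ * θ) * s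
          ≡⟨ solve 5 (λ r d θ n s → r :* (n :- d :* θ) :* s
               := :- (d :* r :* (θ :* s) :- r :* n :* s)) refl (res a μ) (den a μ) θ (num a μ) s ⟩
        - (κ * (θ * s) - res a μ * num a μ * s)
          ≤⟨ ℚ.neg-antimono-≤ (ℚ.+-monoˡ-≤ (- (res a μ * num a μ * s)) (*-monoʳ κ (0≤* (0≤ (den∈ a∈ μ∈)) (0≤res a∈ μ∈))
               (ℚ.*-monoʳ-≤-nonNeg s {{nonNegative 0≤⟦ suc t ⟧}} ≤θ))) ⟩
        - (κ * ((r + r - 1ℚ) * s) - res a μ * num a μ * s)
          ≡⟨ cong (λ z → - (κ * z - res a μ * num a μ * s)) (rate-correlation x ν νs) ⟩
        - deviation (step ν x) νs  ∎

-- From failure bounds to distinguishability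

½+½ : ∀ δ → ½ * δ + ½ * δ ≡ δ
½+½ δ = solve 1 (λ δ → con ½ :* δ :+ con ½ :* δ := δ) refl δ

0<½* : ∀ {δ} → 0ℚ <ℚ δ → 0ℚ <ℚ ½ * δ
0<½* = 0<* (ℚ.positive⁻¹ ½)

≈-refl : ∀ {x} → x ≈ x
≈-refl {x} δ 0<δ = 0 , λ n _ → ℚ.≤-trans (ℚ.≤-reflexive (cong ∣_∣ (ℚ.+-inverseʳ (seq x n)))) (ℚ.<⇒≤ 0<δ)

≈-sym : ∀ {x y} → x ≈ y → y ≈ x
≈-sym {x} {y} x≈y δ 0<δ = proj₁ (x≈y δ 0<δ) , λ n N≤n →
  subst (_≤ℚ δ) (trans (sym (ℚ.∣-p∣≡∣p∣ _)) (cong ∣_∣ (solve 2 (λ p q → :- (p :- q)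
       := q :- p) refl (seq x n) (seq y n))))
    (proj₂ (x≈y δ 0<δ) n N≤n)

≈-trans : ∀ {x y z} → x ≈ y → y ≈ z → x ≈ z
≈-trans {x} {y} {z} x≈y y≈z δ 0<δ with x≈y (½ * δ) (0<½* 0<δ) | y≈z (½ * δ) (0<½* 0<δ)
... | N₁ , c₁ | N₂ , c₂ = N₁ ℕ.⊔ N₂ , λ n N≤n →
  subst₂ _≤ℚ_ (cong ∣_∣ (solve 3 (λ p q r → p :- q :+ (q :- r) := p :- r) refl (seq x n) (seq y n) (seq z n))) (½+½ δ)
    (∣+∣≤ (c₁ n (ℕ.m⊔n≤o⇒m≤o N₁ N₂ N≤n)) (c₂ n (ℕ.m⊔n≤o⇒n≤o N₁ N₂ N≤n)))

fromℚ-injective : ∀ {p q} → fromℚ p ≈ fromℚ q → p ≡ q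
fromℚ-injective {p} {q} p≈q with ℚ.<-cmp 0ℚ ∣ p - q ∣
... | tri> _ _ <0 = contradiction (ℚ.≤-<-trans (ℚ.0≤∣p∣ (p - q)) <0) (ℚ.<-irrefl refl)
... | tri≈ _ 0≡ _ = trans (solve 2 (λ p q → p := p :- q :+ q) refl p q)
  (trans (cong (λ d → d + q) (ℚ.∣p∣≡0⇒p≡0 (p - q) (sym 0≡))) (ℚ.+-identityˡ q))
... | tri< 0< _ _ with ℚ.<-dense 0<
...   | δ , 0<δ , δ< = contradiction (ℚ.<-≤-trans δ< (proj₂ (p≈q δ 0<δ) _ ℕ.≤-refl)) (ℚ.<-irrefl refl)

-- Order on the reals is undecidable, so threshold sets are built from rationals and closed under
-- `≈`. Membership is then decidable at the rational values taken by the statistic.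
rationals : Pred ℚ 0ℓ → Subsetℝ
rationals P = record
  { _∋_      = λ x → ∃[ q ] P q × x ≈ fromℚ q
  ; respects = λ {x} {y} x≈y (q , Pq , x≈q) → q , Pq , ≈-trans {y} {x} {fromℚ q} (≈-sym {x} {y} x≈y) x≈q
  }

rationals-disjoint : ∀ {P Q : Pred ℚ 0ℓ} → (∀ q → P q → ¬ Q q) → Disjoint (rationals P) (rationals Q)
rationals-disjoint {P} P⇒¬Q x ((p , Pp , x≈p) , (q , Qq , x≈q)) = P⇒¬Q q
  (subst P (fromℚ-injective (≈-trans {fromℚ p} {x} {fromℚ q} (≈-sym {x} {fromℚ p} x≈p) x≈q)) Pp) Qq

rationals-dec : ∀ {P : Pred ℚ 0ℓ} → Decidable P → ∀ {x q} → x ≡ fromℚ q → Dec (rationals P ∋ x)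
rationals-dec {P} P? {q = q} refl = map′ (λ Pq → q , Pq , ≈-refl {fromℚ q})
  (λ (p , Pp , q≈p) → subst P (sym (fromℚ-injective q≈p)) Pp) (P? q)

-- `T` depends on `δ` only, while `N` may depend on `t`: inequalities between reals compare late
-- terms, separately for each fixed time.
Reliable : ℝ → RootedGraph → (∀ t → Vec Bool (suc t) → ℚ) → Pred ℚ 0ℓ → Set
Reliable ε (G , u) rate P = ∀ δ → 0ℚ <ℚ δ → ∃[ T ] (∀ t → T ≤ t → ∃[ N ] (∀ k → N ≤ k →
  FailureBound k (law t) (λ ω → P (rate t (observe u ω))) δ))
  where open NVM ε G

indicator : {E : Set} → Dec E → ℚ
indicator E? = if does E? then 1ℚ else 0ℚ

indicator≤1 : {E : Set} (E? : Dec E) → indicator E? ≤ℚ 1ℚ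
indicator≤1 (yes _) = ℚ.≤-refl
indicator≤1 (no _)  = ℚ.nonNegative⁻¹ 1ℚ

-- Pointwise form of the union bound, with `p` and `q` the two Markov functions. The left side is
-- written so that `affine` computes its expectation.
union-bound : ∀ {E F H : Set} (H? : Dec H) → Dec E → Dec F → (E → F → H) → ∀ {p q} → 0ℚ ≤ℚ p → 0ℚ ≤ℚ q →
  (¬ E → 1ℚ ≤ℚ p) → (¬ F → 1ℚ ≤ℚ q) → 1ℚ + (- 1ℚ) * (p + q) ≤ℚ indicator H?
union-bound (yes _) E? F? _ {p} {q} 0≤p 0≤q ¬E⇒ ¬F⇒ = ≤-by (p + q) (ℚ.+-mono-≤ 0≤p 0≤q)
  (solve 1 (λ s → con 1ℚ :+ con (- 1ℚ) :* s :+ s := con 1ℚ) refl (p + q))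
union-bound (no ¬H) (no ¬E) _ _ {p} {q} 0≤p 0≤q ¬E⇒ ¬F⇒ = ≤-by (p - 1ℚ + q) (ℚ.+-mono-≤ (p≤q⇒0≤q-p (¬E⇒ ¬E)) 0≤q)
  (solve 2 (λ p q → con 1ℚ :+ con (- 1ℚ) :* (p :+ q) :+ (p :- con 1ℚ :+ q) := con 0ℚ) refl p q)
union-bound (no ¬H) (yes e) (no ¬F) _ {p} {q} 0≤p 0≤q ¬E⇒ ¬F⇒ = ≤-by (p + (q - 1ℚ)) (ℚ.+-mono-≤ 0≤p (p≤q⇒0≤q-p (¬F⇒ ¬F)))
  (solve 2 (λ p q → con 1ℚ :+ con (- 1ℚ) :* (p :+ q) :+ (p :+ (q :- con 1ℚ)) := con 0ℚ) refl p q)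
union-bound (no ¬H) (yes e) (yes f) E⇒F⇒H 0≤p 0≤q ¬E⇒ ¬F⇒ = contradiction (E⇒F⇒H e f) ¬H

module _ {k} {A B : Set} {μ : Dist A} {ν : Dist B} {E : Pred A 0ℓ} {F : Pred B 0ℓ} {H : Pred (A × B) 0ℓ} {δ}
         (b : FailureBound k μ E δ) (c : FailureBound k ν F δ) (H? : Decidable H) where

  private
    joint : IsProbability k (μ ⊗ ν)
    joint = ⊗-prob k (isProbability b) (isProbability c)

    penalty : A × B → ℚ
    penalty (x , y) = φ b x + φ c y

    𝔼-penalty : 𝔼 k (μ ⊗ ν) penalty ≡ 𝔼 k μ (φ b) + 𝔼 k ν (φ c)
    𝔼-penalty = trans (𝔼-⊗ k μ ν penalty)
      (trans (𝔼-cong k μ (λ x → trans (𝔼-+ k ν (λ _ → φ b x) (φ c)) (cong (λ s → s + 𝔼 k ν (φ c)) (const (isProbability c) (φ b x)))))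
      (trans (𝔼-+ k μ (φ b) (λ _ → 𝔼 k ν (φ c))) (cong (λ s → 𝔼 k μ (φ b) + s) (const (isProbability b) (𝔼 k ν (φ c))))))

  ℙ≤1 : seq (ℙ[ H? ] (μ ⊗ ν)) k ≤ℚ 1ℚ
  ℙ≤1 = subst₂ _≤ℚ_ (sym (ℙ≡𝔼 k H? (μ ⊗ ν))) (mass joint) (mono joint (λ ω → indicator≤1 (H? ω)))

  1-2δ≤ℙ : Decidable E → Decidable F → (∀ x y → E x → F y → H (x , y)) →
           1ℚ - (δ + δ) ≤ℚ seq (ℙ[ H? ] (μ ⊗ ν)) k
  1-2δ≤ℙ E? F? E⇒F⇒H = begin
    1ℚ - (δ + δ)  ≤⟨ ℚ.+-monoʳ-≤ 1ℚ (ℚ.neg-antimono-≤ (ℚ.+-mono-≤ (𝔼φ≤δ b) (𝔼φ≤δ c))) ⟩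
    1ℚ - (𝔼 k μ (φ b) + 𝔼 k ν (φ c))         ≡⟨ cong (λ s → 1ℚ - s) 𝔼-penalty ⟨
    1ℚ - 𝔼 k (μ ⊗ ν) penalty
      ≡⟨ solve 1 (λ s → con 1ℚ :- s := con 1ℚ :+ con (- 1ℚ) :* s) refl (𝔼 k (μ ⊗ ν) penalty) ⟩
    1ℚ + (- 1ℚ) * 𝔼 k (μ ⊗ ν) penalty        ≡⟨ affine joint 1ℚ (- 1ℚ) penalty ⟨
    𝔼 k (μ ⊗ ν) (λ ω → 1ℚ + (- 1ℚ) * penalty ω)
      ≤⟨ mono joint (λ (x , y) → union-bound (H? (x , y)) (E? x) (F? y) (E⇒F⇒H x y) (0≤φ b x) (0≤φ c y) (1≤φ b x) (1≤φ c y)) ⟩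
    𝔼 k (μ ⊗ ν) (λ ω → indicator (H? ω))     ≡⟨ ℙ≡𝔼 k H? (μ ⊗ ν) ⟨
    seq (ℙ[ H? ] (μ ⊗ ν)) k                  ∎
    where open ℚ.≤-Reasoning

⟶1 : (p : ℕ → ℝ) → (∀ δ → 0ℚ <ℚ δ → ∃[ T ] (∀ t → T ≤ t → ∃[ N ] (∀ k → N ≤ k →
       1ℚ - (δ + δ) ≤ℚ seq (p t) k × seq (p t) k ≤ℚ 1ℚ))) → p ⟶ 1ℝ
-- `δ₀` is a rational that eventually lies below `δ`. Taking a quarter of it costs δ₀/2 in total and
-- leaves δ₀/2 as the margin that a strict inequality of reals needs.
⟶1 p bounds δ (δ₀ , 0<δ₀ , N₀ , δ₀≤) with bounds (½ * (½ * δ₀)) (0<½* (0<½* 0<δ₀))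
... | T , b = T , λ t T≤t →
  let N , c = b t T≤t in
  (½ * δ₀ , 0<½* 0<δ₀ , N₀ ℕ.⊔ N , λ k N≤k → begin
    1ℚ - seq δ k + ½ * δ₀
      ≤⟨ ℚ.+-monoˡ-≤ (½ * δ₀) (ℚ.+-monoʳ-≤ 1ℚ (ℚ.neg-antimono-≤ (δ₀≤δ k (ℕ.m⊔n≤o⇒m≤o N₀ N N≤k)))) ⟩
    1ℚ - δ₀ + ½ * δ₀
      ≡⟨ solve 1 (λ d → con 1ℚ :- d :+ con ½ :* d
           := con 1ℚ :- (con ½ :* (con ½ :* d) :+ con ½ :* (con ½ :* d))) refl δ₀ ⟩
    1ℚ - (½ * (½ * δ₀) + ½ * (½ * δ₀))  ≤⟨ proj₁ (c k (ℕ.m⊔n≤o⇒n≤o N₀ N N≤k)) ⟩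
    seq (p t) k             ∎) ,
  (½ * δ₀ , 0<½* 0<δ₀ , N₀ ℕ.⊔ N , λ k N≤k → begin
    seq (p t) k + ½ * δ₀
      ≤⟨ ℚ.+-mono-≤ (proj₂ (c k (ℕ.m⊔n≤o⇒n≤o N₀ N N≤k))) (≤-by (½ * δ₀) (ℚ.<⇒≤ (0<½* 0<δ₀)) (½+½ δ₀)) ⟩
    1ℚ + δ₀                 ≤⟨ ℚ.+-monoʳ-≤ 1ℚ (δ₀≤δ k (ℕ.m⊔n≤o⇒m≤o N₀ N N≤k)) ⟩
    1ℚ + seq δ k            ∎)
  where
  open ℚ.≤-Reasoning
  δ₀≤δ : ∀ k → N₀ ≤ k → δ₀ ≤ℚ seq δ k
  δ₀≤δ k N₀≤k = subst (_≤ℚ seq δ k) (ℚ.+-identityˡ δ₀) (δ₀≤ k N₀≤k)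

∋-fromℚ : ∀ {P : Pred ℚ 0ℓ} {x q} → x ≡ fromℚ q → P q → rationals P ∋ x
∋-fromℚ {q = q} refl Pq = q , Pq , ≈-refl {fromℚ q}

distinguishable : ∀ {ε} (G₁ G₂ : RootedGraph) {S rate} {P Q : Pred ℚ 0ℓ} → (∀ t X → S t X ≡ fromℚ (rate t X)) →
  Decidable P → Decidable Q → (∀ q → P q → ¬ Q q) →
  Reliable ε G₁ rate P → Reliable ε G₂ rate Q → Distinguishable ε G₁ G₂ S
distinguishable {ε} (G₁ , u₁) (G₂ , u₂) {S} {rate} {P} {Q} S≡rate P? Q? P⇒¬Q reliable₁ reliable₂ =
  (λ _ → rationals P) , (λ _ → rationals Q) , (λ _ → rationals-disjoint {P} {Q} P⇒¬Q) ,
  H? , ⟶1 (λ t → ℙ[ H? t ] (M₁.law t ⊗ M₂.law t)) bounds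
  where
  module M₁ = NVM ε G₁
  module M₂ = NVM ε G₂
  H : ∀ t → Pred (M₁.Ω t × M₂.Ω t) 0ℓ
  H t (ω₁ , ω₂) = (rationals P ∋ S t (M₁.observe u₁ ω₁)) × (rationals Q ∋ S t (M₂.observe u₂ ω₂))
  H? : ∀ t → Decidable (H t)
  H? t (ω₁ , ω₂) = rationals-dec {P} P? (S≡rate t (M₁.observe u₁ ω₁)) ×-dec rationals-dec {Q} Q? (S≡rate t (M₂.observe u₂ ω₂))
  bounds : ∀ δ → 0ℚ <ℚ δ → ∃[ T ] (∀ t → T ≤ t → ∃[ N ] (∀ k → N ≤ k →
    1ℚ - (δ + δ) ≤ℚ seq (ℙ[ H? t ] (M₁.law t ⊗ M₂.law t)) k × seq (ℙ[ H? t ] (M₁.law t ⊗ M₂.law t)) k ≤ℚ 1ℚ))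
  bounds δ 0<δ = let T₁ , b₁ = reliable₁ δ 0<δ ; T₂ , b₂ = reliable₂ δ 0<δ in T₁ ℕ.⊔ T₂ , λ t T≤t →
    combine t (b₁ t (ℕ.m⊔n≤o⇒m≤o T₁ T₂ T≤t)) (b₂ t (ℕ.m⊔n≤o⇒n≤o T₁ T₂ T≤t))
    where
    combine : ∀ t →
      ∃[ N ] (∀ k → N ≤ k → FailureBound k (M₁.law t) (λ ω → P (rate t (M₁.observe u₁ ω))) δ) →
      ∃[ N ] (∀ k → N ≤ k → FailureBound k (M₂.law t) (λ ω → Q (rate t (M₂.observe u₂ ω))) δ) →
      ∃[ N ] (∀ k → N ≤ k → 1ℚ - (δ + δ) ≤ℚ seq (ℙ[ H? t ] (M₁.law t ⊗ M₂.law t)) k ×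
                            seq (ℙ[ H? t ] (M₁.law t ⊗ M₂.law t)) k ≤ℚ 1ℚ)
    combine t (N₁ , c₁) (N₂ , c₂) = N₁ ℕ.⊔ N₂ , λ k N≤k →
      let b = c₁ k (ℕ.m⊔n≤o⇒m≤o N₁ N₂ N≤k)
          c = c₂ k (ℕ.m⊔n≤o⇒n≤o N₁ N₂ N≤k)
      in 1-2δ≤ℙ b c (H? t) (λ (ω : M₁.Ω t) → P? (rate t (M₁.observe u₁ ω))) (λ (ω : M₂.Ω t) → Q? (rate t (M₂.observe u₂ ω)))
           (λ ω₁ ω₂ p q → ∋-fromℚ {P} (S≡rate t (M₁.observe u₁ ω₁)) p , ∋-fromℚ {Q} (S≡rate t (M₂.observe u₂ ω₂)) q) ,
         ℙ≤1 b c (H? t)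

-- Separating the two stationary correlations

⟦⟧-mono : ∀ {m n} → m ≤ n → ⟦ m ⟧ ≤ℚ ⟦ n ⟧
⟦⟧-mono {n = n} z≤n = 0≤⟦ n ⟧
⟦⟧-mono (s≤s m≤n)  = ℚ.+-monoʳ-≤ 1ℚ (⟦⟧-mono m≤n)

⟦⟧-injective : ∀ m n → ⟦ m ⟧ ≡ ⟦ n ⟧ → m ≡ n
⟦⟧-injective m n eq = ℤ.+-injective (trans (sym (ℤ.*-identityʳ (+ m)))
  (trans (ℚᵘ.drop-*≡* (ℚᵘ.≃-trans (ℚᵘ.≃-sym (toℚᵘ-⟦⟧ m)) (ℚᵘ.≃-trans (ℚᵘ.≃-reflexive (cong toℚᵘ eq)) (toℚᵘ-⟦⟧ n))))
    (ℤ.*-identityʳ (+ n))))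

archimedean : ∀ p → ∃[ n ] p ≤ℚ ⟦ n ⟧
archimedean p@(mkℚ i d _) = ℤ.∣ i ∣ , ℚ.toℚᵘ-cancel-≤ (ℚᵘ.≤-respʳ-≃ (ℚᵘ.≃-sym (toℚᵘ-⟦⟧ ℤ.∣ i ∣)) (*≤* (bound i)))
  where
  bound : ∀ i → i ℤ.* + 1 ℤ.≤ + ℤ.∣ i ∣ ℤ.* + suc d
  bound i = ℤ.≤-trans (ℤ.≤-reflexive (ℤ.*-identityʳ i)) (ℤ.≤-trans (i≤∣i∣ i)
    (subst (+ ℤ.∣ i ∣ ℤ.≤_) (ℤ.pos-* ℤ.∣ i ∣ (suc d)) (+≤+ (ℕ.m≤m*n ℤ.∣ i ∣ (suc d)))))
    where
    i≤∣i∣ : ∀ i → i ℤ.≤ + ℤ.∣ i ∣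
    i≤∣i∣ (+ n)    = ℤ.≤-refl
    i≤∣i∣ -[1+ n ] = -≤+

archimedean-* : ∀ p {c} → 0ℚ <ℚ c → ∃[ T ] (∀ t → T ≤ t → p ≤ℚ c * ⟦ t ⟧)
archimedean-* p {c} 0<c with reciprocal 0<c
... | w , _ , wc with archimedean (w * p)
...   | T , wp≤T = T , λ t T≤t → subst (_≤ℚ c * ⟦ t ⟧)
  (trans (solve 3 (λ c w p → c :* (w :* p) := w :* c :* p) refl c w p) (trans (cong (_* p) wc) (ℚ.*-identityˡ p)))
  (*-monoʳ c (ℚ.<⇒≤ 0<c) (ℚ.≤-trans wp≤T (⟦⟧-mono T≤t)))

p≤∣p∣ : ∀ p → p ≤ℚ ∣ p ∣
p≤∣p∣ p with ℚ.≤-total 0ℚ p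
... | inj₁ 0≤p = ℚ.≤-reflexive (sym (ℚ.0≤p⇒∣p∣≡p 0≤p))
... | inj₂ p≤0 = ℚ.≤-trans p≤0 (ℚ.0≤∣p∣ p)

-- With r = p + e and e = d + 1 the two sides differ by e (pr - 1). Equality forces pr = 1, so p = r
-- = 1, which contradicts e > 0.
ℕ-coalesce-strict : ∀ p d → p ℕ.+ p ℕ.* (p ℕ.+ suc d) ℕ.* (p ℕ.+ suc d) ≢ p ℕ.+ suc d ℕ.+ p ℕ.* p ℕ.* (p ℕ.+ suc d)
ℕ-coalesce-strict p d eq = ℕ.m+1+n≢m 1 (trans (cong (ℕ._+ suc d) (sym p≡1)) r≡1)
  where
  r = p ℕ.+ suc d
  c = p ℕ.+ p ℕ.* r ℕ.* p
  cancelled : p ℕ.* r ℕ.* suc d ≡ 1 ℕ.* suc d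
  cancelled = ℕ.+-cancelˡ-≡ c _ _ (trans
    (solveℕ 2 (λ p e → let r = p ⊕ e in p ⊕ p ⊛′ r ⊛′ p ⊕ p ⊛′ r ⊛′ e ⊜ p ⊕ p ⊛′ r ⊛′ r) refl p (suc d))
    (trans eq (solveℕ 2 (λ p e → let r = p ⊕ e in p ⊕ e ⊕ p ⊛′ p ⊛′ r ⊜ p ⊕ p ⊛′ r ⊛′ p ⊕ conℕ 1 ⊛′ e) refl p (suc d))))
    where
    open ℕ.+-*-Solver using () renaming (solve to solveℕ; _:+_ to infixl 6 _⊕_; _:*_ to infixl 7 _⊛′_; _:=_ to infix 4 _⊜_; con to conℕ)
  pr≡1 : p ℕ.* r ≡ 1
  pr≡1 = ℕ.*-cancelʳ-≡ (p ℕ.* r) 1 (suc d) cancelled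
  p≡1 : p ≡ 1
  p≡1 = ℕ.m*n≡1⇒m≡1 p r pr≡1
  r≡1 : r ≡ 1
  r≡1 = ℕ.m*n≡1⇒n≡1 p r pr≡1

-- The equation coalesce (1/(p+1)) = coalesce (1/(r+1)) amounts to (p - r)(p r - 1) = 0,
-- stated here with both sides moved so that no subtraction occurs.
ℕ-coalesce-injective : ∀ p r → p ℕ.+ p ℕ.* r ℕ.* r ≡ r ℕ.+ p ℕ.* p ℕ.* r → p ≡ r
ℕ-coalesce-injective p r eq with ℕ.<-cmp p r
... | tri≈ _ p≡r _ = p≡r
... | tri< p<r _ _ with ℕ.m≤n⇒∃[o]m+o≡n p<r
...   | d , refl = contradiction (subst (λ r → p ℕ.+ p ℕ.* r ℕ.* r ≡ r ℕ.+ p ℕ.* p ℕ.* r)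
            (sym (ℕ.+-suc p d)) eq) (ℕ-coalesce-strict p d)
ℕ-coalesce-injective p r eq | tri> _ _ r<p with ℕ.m≤n⇒∃[o]m+o≡n r<p
...   | d , refl = contradiction (subst (λ p → r ℕ.+ r ℕ.* p ℕ.* p ≡ p ℕ.+ r ℕ.* r ℕ.* p)
            (sym (ℕ.+-suc r d)) eq′) (ℕ-coalesce-strict r d)
  where
  q = suc r ℕ.+ d
  eq′ : r ℕ.+ r ℕ.* q ℕ.* q ≡ q ℕ.+ r ℕ.* r ℕ.* q
  eq′ = trans (cong (r ℕ.+_) (trans (ℕ.*-assoc r q q) (ℕ.*-comm r (q ℕ.* q))))
    (trans (sym eq) (cong (q ℕ.+_) (trans (ℕ.*-assoc q r r) (ℕ.*-comm q (r ℕ.* r)))))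

-- Clearing denominators gives P (1 + R)² = R (1 + P)²; the terms 2PR cancel and the equation
-- descends to natural numbers.
coalesce-injective : ∀ p r {w v} → w * ⟦ suc p ⟧ ≡ 1ℚ → v * ⟦ suc r ⟧ ≡ 1ℚ → coalesce w ≡ coalesce v → p ≡ r
coalesce-injective p r {w} {v} wM vL eq = ℕ-coalesce-injective p r (⟦⟧-injective _ _ (begin
  ⟦ p ℕ.+ p ℕ.* r ℕ.* r ⟧           ≡⟨ homo p r ⟩
  P + P * R * R                      ≡⟨ solve 2 (λ P R → P :+ P :* R :* R
       := R :+ P :* P :* R :+ (P :+ P :* R :* R :- (R :+ P :* P :* R))) refl P R ⟩
  R + P * P * R + (P + P * R * R - (R + P * P * R))  ≡⟨ cong (λ z → R + P * P * R + z) difference ⟩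
  R + P * P * R + 0ℚ                 ≡⟨ ℚ.+-identityʳ _ ⟩
  R + P * P * R                      ≡⟨ homo′ ⟨
  ⟦ r ℕ.+ p ℕ.* p ℕ.* r ⟧           ∎))
  where
  open ≡-Reasoning
  P = ⟦ p ⟧
  R = ⟦ r ⟧
  homo* : ∀ a b c → ⟦ a ℕ.* b ℕ.* c ⟧ ≡ ⟦ a ⟧ * ⟦ b ⟧ * ⟦ c ⟧
  homo* a b c = trans (×1-homo-* (a ℕ.* b) c) (cong (_* ⟦ c ⟧) (×1-homo-* a b))
  homo : ∀ a b → ⟦ a ℕ.+ a ℕ.* b ℕ.* b ⟧ ≡ ⟦ a ⟧ + ⟦ a ⟧ * ⟦ b ⟧ * ⟦ b ⟧
  homo a b = trans (×-homo-+ 1ℚ a (a ℕ.* b ℕ.* b)) (cong (λ z → ⟦ a ⟧ + z) (homo* a b b))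
  homo′ : ⟦ r ℕ.+ p ℕ.* p ℕ.* r ⟧ ≡ R + P * P * R
  homo′ = trans (×-homo-+ 1ℚ r (p ℕ.* p ℕ.* r)) (cong (λ z → R + z) (homo* p p r))
  -- At x = y = 1 this is P (1 + R)² - R (1 + P)². At x = w (1 + P), y = v (1 + R) it is a multiple
  -- of `coalesce w - coalesce v`; the hypotheses identify the two evaluations.
  F : ℚ → ℚ → ℚ
  F x y = (x * (1ℚ + P) - x * x) * ((1ℚ + R) * (1ℚ + R)) - (y * (1ℚ + R) - y * y) * ((1ℚ + P) * (1ℚ + P))
  difference : P + P * R * R - (R + P * P * R) ≡ 0ℚ
  difference = begin
    P + P * R * R - (R + P * P * R)
      ≡⟨ solve 2 (λ P R → P :+ P :* R :* R :- (R :+ P :* P :* R) :=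
           (con 1ℚ :* (con 1ℚ :+ P) :- con 1ℚ :* con 1ℚ) :* ((con 1ℚ :+ R) :* (con 1ℚ :+ R)) :-
           (con 1ℚ :* (con 1ℚ :+ R) :- con 1ℚ :* con 1ℚ) :* ((con 1ℚ :+ P) :* (con 1ℚ :+ P))) refl P R ⟩
    F 1ℚ 1ℚ                                   ≡⟨ cong₂ F wM vL ⟨
    F (w * (1ℚ + P)) (v * (1ℚ + R))
      ≡⟨ solve 4 (λ P R w v → let M = con 1ℚ :+ P ; L = con 1ℚ :+ R ; x = w :* M ; y = v :* L in
           (x :* M :- x :* x) :* (L :* L) :- (y :* L :- y :* y) :* (M :* M) :=
           M :* M :* (L :* L) :* (w :- w :* w :- (v :- v :* v))) refl P R w v ⟩
    (1ℚ + P) * (1ℚ + P) * ((1ℚ + R) * (1ℚ + R)) * (coalesce w - coalesce v)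
      ≡⟨ cong (λ z → (1ℚ + P) * (1ℚ + P) * ((1ℚ + R) * (1ℚ + R)) * (z - coalesce v)) eq ⟩
    (1ℚ + P) * (1ℚ + P) * ((1ℚ + R) * (1ℚ + R)) * (coalesce v - coalesce v)
      ≡⟨ solve 2 (λ z c → z :* (c :- c) := con 0ℚ) refl ((1ℚ + P) * (1ℚ + P) * ((1ℚ + R) * (1ℚ + R))) (coalesce v) ⟩
    0ℚ ∎

-- The witness (n₁ + n₂)/(d₁ + d₂) lies between the two fractions. Both excesses equal the cross
-- difference divided by d₁ + d₂, which is at most 2; hence the factor `½`.
mediant : ∀ {d₁ d₂ n₁ n₂ g} → Unit d₁ → Unit d₂ → 0ℚ <ℚ d₁ + d₂ → 0ℚ ≤ℚ n₁ → 0ℚ ≤ℚ n₂ → n₁ ≤ℚ d₁ → n₂ ≤ℚ d₂ →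
  0ℚ ≤ℚ g → g ≤ℚ d₁ * n₂ - d₂ * n₁ →
  ∃[ θ ] ∣ θ ∣ ≤ℚ 1ℚ × ½ * g ≤ℚ d₁ * θ - n₁ × ½ * g ≤ℚ n₂ - d₂ * θ
mediant {d₁} {d₂} {n₁} {n₂} {g} d₁∈ d₂∈ 0<s 0≤n₁ 0≤n₂ n₁≤d₁ n₂≤d₂ 0≤g g≤ with reciprocal 0<s
... | w , 0≤w , ws = w * (n₁ + n₂) ,
  0≤p≤q⇒∣p∣≤q (0≤* 0≤w (ℚ.+-mono-≤ 0≤n₁ 0≤n₂)) (subst (w * (n₁ + n₂) ≤ℚ_) ws (*-monoʳ w 0≤w (ℚ.+-mono-≤ n₁≤d₁ n₂≤d₂))) ,
  subst (½ * g ≤ℚ_) below-θ half , subst (½ * g ≤ℚ_) above-θ half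
  where
  open ℚ.≤-Reasoning
  ½≤w : ½ ≤ℚ w
  ½≤w = begin
    ½                        ≡⟨ cong (½ *_) ws ⟨
    ½ * (w * (d₁ + d₂))      ≤⟨ *-monoʳ ½ (ℚ.nonNegative⁻¹ ½) (*-monoʳ w 0≤w (ℚ.+-mono-≤ (≤1 d₁∈) (≤1 d₂∈))) ⟩
    ½ * (w * (1ℚ + 1ℚ))      ≡⟨ solve 1 (λ w → con ½ :* (w :* (con 1ℚ :+ con 1ℚ)) := w) refl w ⟩
    w                        ∎
  half : ½ * g ≤ℚ w * (d₁ * n₂ - d₂ * n₁)
  half = *-mono (ℚ.nonNegative⁻¹ ½) 0≤g ½≤w g≤
  below-θ : w * (d₁ * n₂ - d₂ * n₁) ≡ d₁ * (w * (n₁ + n₂)) - n₁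
  below-θ = trans
    (solve 5 (λ w d₁ d₂ n₁ n₂ → w :* (d₁ :* n₂ :- d₂ :* n₁)
         := d₁ :* (w :* (n₁ :+ n₂)) :- w :* (d₁ :+ d₂) :* n₁) refl w d₁ d₂ n₁ n₂)
    (cong (λ z → d₁ * (w * (n₁ + n₂)) - z) (trans (cong (_* n₁) ws) (ℚ.*-identityˡ n₁)))
  above-θ : w * (d₁ * n₂ - d₂ * n₁) ≡ n₂ - d₂ * (w * (n₁ + n₂))
  above-θ = trans
    (solve 5 (λ w d₁ d₂ n₁ n₂ → w :* (d₁ :* n₂ :- d₂ :* n₁)
         := w :* (d₁ :+ d₂) :* n₂ :- d₂ :* (w :* (n₁ :+ n₂))) refl w d₁ d₂ n₁ n₂)
    (cong (λ z → z - d₂ * (w * (n₁ + n₂))) (trans (cong (_* n₂) ws) (ℚ.*-identityˡ n₂)))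

perturb : ∀ {x y h η} → ∣ x - y ∣ ≤ℚ η → h ≤ℚ x → h - η ≤ℚ y
perturb {x} {y} {h} {η} ∣x-y∣≤η h≤x = begin
  h - η        ≤⟨ ℚ.+-mono-≤ h≤x (ℚ.neg-antimono-≤ (ℚ.≤-trans (p≤∣p∣ (x - y)) ∣x-y∣≤η)) ⟩
  x - (x - y)  ≡⟨ solve 2 (λ x y → x :- (x :- y) := y) refl x y ⟩
  y            ∎
  where open ℚ.≤-Reasoning

module _ {a μ : ℚ} (a∈ : Unit a) (μ∈ : Unit μ) where

  1-a²≤den : 1ℚ - a * a ≤ℚ den a μ
  1-a²≤den = ≤-by (a * a * coalesce μ) (0≤ ((a∈ ⊛ a∈) ⊛ coalesce∈ μ∈)) refl

  num≤den : num a μ ≤ℚ den a μ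
  num≤den = ≤-by (1ℚ - a * a + a * a * coalesce μ * (1ℚ - a))
    (ℚ.+-mono-≤ (0≤ (co (a∈ ⊛ a∈))) (0≤ (((a∈ ⊛ a∈) ⊛ coalesce∈ μ∈) ⊛ co a∈)))
    (solve 2 (λ a o → a :* a :* a :* o :+ (con 1ℚ :- a :* a :+ a :* a :* o :* (con 1ℚ :- a))
         := con 1ℚ :- a :* a :+ a :* a :* o) refl a (coalesce μ))

1-a≤1-a² : ∀ {a} → Unit a → 1ℚ - a ≤ℚ 1ℚ - a * a
1-a≤1-a² {a} a∈ = ≤-by (a * (1ℚ - a)) (0≤ (a∈ ⊛ co a∈))
  (solve 1 (λ a → con 1ℚ :- a :+ a :* (con 1ℚ :- a) := con 1ℚ :- a :* a) refl a)

-- The cross difference is exactly a³ (1 - a²)(o₂ - o₁). Replacing `a` and 1 - a² by the lower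
-- bounds `c` and `d` makes the gap independent of the index.
cross-gap : ∀ {a μ₁ μ₂ c d} → Unit a → 0ℚ ≤ℚ c → 0ℚ ≤ℚ d → c ≤ℚ a → d ≤ℚ 1ℚ - a * a → coalesce μ₁ ≤ℚ coalesce μ₂ →
  c * c * c * d * (coalesce μ₂ - coalesce μ₁) ≤ℚ den a μ₁ * num a μ₂ - den a μ₂ * num a μ₁
cross-gap {a} {μ₁} {μ₂} {c} {d} a∈ 0≤c 0≤d c≤a d≤ o₁≤o₂ = ℚ.≤-trans
  (ℚ.*-monoʳ-≤-nonNeg (coalesce μ₂ - coalesce μ₁) {{nonNegative (p≤q⇒0≤q-p o₁≤o₂)}}
    (*-mono (0≤* (0≤* 0≤c 0≤c) 0≤c) 0≤d (*-mono (0≤* 0≤c 0≤c) 0≤c (*-mono 0≤c 0≤c c≤a c≤a) c≤a) d≤))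
  (ℚ.≤-reflexive (solve 3 (λ a o p → a :* a :* a :* (con 1ℚ :- a :* a) :* (p :- o) :=
      (con 1ℚ :- a :* a :+ a :* a :* o) :* (a :* a :* a :* p) :- (con 1ℚ :- a :* a :+ a :* a :* p) :* (a :* a :* a :* o)) refl
    a (coalesce μ₁) (coalesce μ₂)))

-- Real numbers whose k-th terms are `den` and `num` at the k-th term of `a`, so that their Cauchy
-- moduli control the variation with k.
denℝ numℝ : ℝ → ℚ → ℝ
denℝ ε μ = let a = 1ℝ Defs.- ε in 1ℝ Defs.- a Defs.* a Defs.+ a Defs.* a Defs.* fromℚ (coalesce μ)
numℝ ε μ = let a = 1ℝ Defs.- ε in a Defs.* a Defs.* a Defs.* fromℚ (coalesce μ)

Separated : ℝ → ℚ → ℚ → ℚ → ℚ → ℕ → Set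
Separated ε μ₁ μ₂ θ γ k = let a = 1ℚ - seq ε k in Unit (seq ε k) ×
  γ ≤ℚ res a μ₁ * (den a μ₁ * θ - num a μ₁) × γ ≤ℚ res a μ₂ * (num a μ₂ - den a μ₂ * θ)

-- A single rational `θ` must serve all large k: it is the mediant at index `N`, and the Cauchy
-- moduli carry both gaps to every later index. The witnesses of 0 < ε < 1 supply `d` below ε and
-- `c` below `a`; since `res` is at least 1 - a² and hence at least `d`, the final margin carries
-- the factor `d`.
threshold : ∀ ε → 0ℝ < ε → ε < 1ℝ → ∀ {μ₁ μ₂} → Unit μ₁ → Unit μ₂ → coalesce μ₁ <ℚ coalesce μ₂ →
  ∃[ θ ] ∃[ γ ] 0ℚ <ℚ γ × ∃[ N ] (∀ k → N ≤ k → Separated ε μ₁ μ₂ θ γ k)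
threshold ε (d , 0<d , N₁ , d≤ε) (c , 0<c , N₂ , ε≤1-c) {μ₁} {μ₂} μ₁∈ μ₂∈ o₁<o₂ =
  θ , d * (½ * g - (η + η)) , 0<* 0<d 0<h , N , separated
  where
  open ℚ.≤-Reasoning
  gap = coalesce μ₂ - coalesce μ₁
  0<gap : 0ℚ <ℚ gap
  0<gap = subst (_<ℚ gap) (ℚ.+-inverseʳ (coalesce μ₁)) (ℚ.+-monoˡ-< (- coalesce μ₁) o₁<o₂)
  g = c * c * c * d * gap
  0<g : 0ℚ <ℚ g
  0<g = 0<* (0<* (0<* (0<* 0<c 0<c) 0<c) 0<d) 0<gap
  -- With η = g/8 the change of index costs 2η = g/4 of the half gap g/2: one η from `num` and one
  -- from `den * θ`, as |θ| is at most 1.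
  η = ½ * (½ * (½ * g))
  0<η : 0ℚ <ℚ η
  0<η = 0<½* (0<½* (0<½* 0<g))
  0<h : 0ℚ <ℚ ½ * g - (η + η)
  0<h = subst (0ℚ <ℚ_) (solve 1 (λ g → con ½ :* (con ½ :* g)
       := con ½ :* g :- (con ½ :* (con ½ :* (con ½ :* g)) :+ con ½ :* (con ½ :* (con ½ :* g)))) refl g)
    (0<½* (0<½* 0<g))
  D₁ = cauchy (denℝ ε μ₁) η 0<η
  D₂ = cauchy (denℝ ε μ₂) η 0<η
  C₁ = cauchy (numℝ ε μ₁) η 0<η
  C₂ = cauchy (numℝ ε μ₂) η 0<η
  N₃ = (proj₁ D₁ ℕ.⊔ proj₁ C₁) ℕ.⊔ (proj₁ D₂ ℕ.⊔ proj₁ C₂)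
  N = (N₁ ℕ.⊔ N₂) ℕ.⊔ N₃
  a : ℕ → ℚ
  a k = 1ℚ - seq ε k
  module _ {k} (N≤k : N ≤ k) where
    N₁₂≤k = ℕ.m⊔n≤o⇒m≤o (N₁ ℕ.⊔ N₂) N₃ N≤k
    d≤ : d ≤ℚ seq ε k
    d≤ = subst (_≤ℚ seq ε k) (ℚ.+-identityˡ d) (d≤ε k (ℕ.m⊔n≤o⇒m≤o N₁ N₂ N₁₂≤k))
    +c≤1 : seq ε k + c ≤ℚ 1ℚ
    +c≤1 = ε≤1-c k (ℕ.m⊔n≤o⇒n≤o N₁ N₂ N₁₂≤k)
    ε∈ : Unit (seq ε k)
    ε∈ = unit (ℚ.≤-trans (ℚ.<⇒≤ 0<d) d≤) (ℚ.≤-trans (≤-by c (ℚ.<⇒≤ 0<c) refl) +c≤1)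
    a∈ : Unit (a k)
    a∈ = co ε∈
    c≤a : c ≤ℚ a k
    c≤a = subst (_≤ℚ a k) (solve 2 (λ e c → e :+ c :- e := c) refl (seq ε k) c) (ℚ.+-monoˡ-≤ (- seq ε k) +c≤1)
    d≤1-a² : d ≤ℚ 1ℚ - a k * a k
    d≤1-a² = begin
      d              ≤⟨ d≤ ⟩
      seq ε k        ≡⟨ solve 1 (λ e → e := con 1ℚ :- (con 1ℚ :- e)) refl (seq ε k) ⟩
      1ℚ - a k       ≤⟨ 1-a≤1-a² a∈ ⟩
      1ℚ - a k * a k ∎
  aN∈ = a∈ ℕ.≤-refl
  0<den : ∀ {μ} → Unit μ → 0ℚ <ℚ den (a N) μ
  0<den μ∈ = ℚ.<-≤-trans 0<d (ℚ.≤-trans (d≤1-a² ℕ.≤-refl) (1-a²≤den aN∈ μ∈))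
  med = mediant (den∈ aN∈ μ₁∈) (den∈ aN∈ μ₂∈) (ℚ.+-mono-< (0<den μ₁∈) (0<den μ₂∈))
    (0≤ (num∈ aN∈ μ₁∈)) (0≤ (num∈ aN∈ μ₂∈)) (num≤den aN∈ μ₁∈) (num≤den aN∈ μ₂∈) (ℚ.<⇒≤ 0<g)
    (cross-gap {a N} {μ₁} {μ₂} aN∈ (ℚ.<⇒≤ 0<c) (ℚ.<⇒≤ 0<d) (c≤a ℕ.≤-refl) (d≤1-a² ℕ.≤-refl) (ℚ.<⇒≤ o₁<o₂))
  θ = proj₁ med
  ∣θ∣≤1 = proj₁ (proj₂ med)
  scaled : ∀ {x k μ} → N ≤ k → Unit μ → ½ * g - (η + η) ≤ℚ x → d * (½ * g - (η + η)) ≤ℚ res (a k) μ * x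
  scaled N≤k μ∈ ≤x = *-mono (ℚ.<⇒≤ 0<d) (ℚ.<⇒≤ 0<h) (ℚ.≤-trans (d≤1-a² N≤k) (1-a²≤res (a∈ N≤k) μ∈)) ≤x
  separated : ∀ k → N ≤ k → Separated ε μ₁ μ₂ θ (d * (½ * g - (η + η))) k
  separated k N≤k = ε∈ N≤k ,
    scaled N≤k μ₁∈ (perturb
      (subst₂ _≤ℚ_ (cong ∣_∣ (solve 5 (λ d d′ n n′ θ → (d :- d′) :* θ :- (n :- n′)
           := d :* θ :- n :- (d′ :* θ :- n′)) refl
            (den (a N) μ₁) (den (a k) μ₁) (num (a N) μ₁) (num (a k) μ₁) θ)) (cong (λ z → z + η) (ℚ.*-identityʳ η))
        (∣-∣≤ (∣*∣≤ (proj₂ D₁ N k D₁≤N (ℕ.≤-trans D₁≤N N≤k)) ∣θ∣≤1) (proj₂ C₁ N k C₁≤N (ℕ.≤-trans C₁≤N N≤k))))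
      (proj₁ (proj₂ (proj₂ med)))) ,
    scaled N≤k μ₂∈ (perturb
      (subst₂ _≤ℚ_ (cong ∣_∣ (solve 5 (λ d d′ n n′ θ → n :- n′ :- (d :- d′) :* θ := n :- d :* θ :- (n′ :- d′ :* θ)) refl
            (den (a N) μ₂) (den (a k) μ₂) (num (a N) μ₂) (num (a k) μ₂) θ)) (cong (λ z → η + z) (ℚ.*-identityʳ η))
        (∣-∣≤ (proj₂ C₂ N k C₂≤N (ℕ.≤-trans C₂≤N N≤k)) (∣*∣≤ (proj₂ D₂ N k D₂≤N (ℕ.≤-trans D₂≤N N≤k)) ∣θ∣≤1)))
      (proj₂ (proj₂ (proj₂ med))))
    where
    N₃≤N = ℕ.m≤n⊔m (N₁ ℕ.⊔ N₂) N₃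
    1≤N = ℕ.m⊔n≤o⇒m≤o (proj₁ D₁ ℕ.⊔ proj₁ C₁) (proj₁ D₂ ℕ.⊔ proj₁ C₂) N₃≤N
    2≤N = ℕ.m⊔n≤o⇒n≤o (proj₁ D₁ ℕ.⊔ proj₁ C₁) (proj₁ D₂ ℕ.⊔ proj₁ C₂) N₃≤N
    D₁≤N = ℕ.m⊔n≤o⇒m≤o (proj₁ D₁) (proj₁ C₁) 1≤N
    C₁≤N = ℕ.m⊔n≤o⇒n≤o (proj₁ D₁) (proj₁ C₁) 1≤N
    D₂≤N = ℕ.m⊔n≤o⇒m≤o (proj₁ D₂) (proj₁ C₂) 2≤N
    C₂≤N = ℕ.m⊔n≤o⇒n≤o (proj₁ D₂) (proj₁ C₂) 2≤N

-- The theorem for complete graphs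

1/suc∈ : ∀ p → Unit (+ 1 ℚ./ suc p)
1/suc∈ p = unit (0≤1/n (suc p)) (subst₂ _≤ℚ_ (ℚ.*-identityʳ w) (1/n*n (suc p))
  (*-monoʳ w (0≤1/n (suc p)) (≤-by ⟦ p ⟧ 0≤⟦ p ⟧ refl)))
  where w = + 1 ℚ./ suc p

[2+p]/[1+p] : ∀ p → ⟦ suc (suc p) ⟧ * (+ 1 ℚ./ suc p) ≡ 1ℚ + (+ 1 ℚ./ suc p)
[2+p]/[1+p] p = expand (+ 1 ℚ./ suc p) ⟦ suc p ⟧ (1/n*n (suc p))
  where
  expand : ∀ w m → w * m ≡ 1ℚ → (1ℚ + m) * w ≡ 1ℚ + w
  expand w m wm = trans (solve 2 (λ w m → (con 1ℚ :+ m) :* w := w :* m :+ w) refl w m) (cong (λ z → z + w) wm)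

K₂₊ : ∀ p → Fin (suc (suc p)) → RootedGraph
K₂₊ p u = K (suc (suc p)) (s≤s (s≤s z≤n)) , u

repetitionRate : ∀ t → Vec Bool (suc t) → ℚ
repetitionRate t X = averageℚ (repeats 1 t X)

module _ (ε : ℝ) {p : ℕ} (u : Fin (suc (suc p))) {θ γ : ℚ} (0<γ : 0ℚ <ℚ γ) (N : ℕ) where

  private
    n : ℕ
    n = suc (suc p)
    μ : ℚ
    μ = + 1 ℚ./ suc p
    a : ℕ → ℚ
    a k = 1ℚ - seq ε k

    module G (k : ℕ) (ε∈ : Unit (seq ε k)) =
      CompleteGraph k ε ε∈ {n} (s≤s (s≤s z≤n)) u μ ([2+p]/[1+p] p) (1/suc∈ p)

    enough : ∀ δ → 0ℚ <ℚ δ → ∃[ T ] (∀ t → T ≤ t → 4ℚ * (gainBound n * gainBound n) ≤ℚ δ * (γ * γ) * ⟦ t ⟧)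
    enough δ 0<δ = archimedean-* _ (0<* 0<δ (0<* 0<γ 0<γ))

    reliable : ∀ {P : Pred ℚ 0ℓ} →
      (∀ k → N ≤ k → ∀ t {δ} → 0ℚ ≤ℚ δ → 4ℚ * (gainBound n * gainBound n) ≤ℚ δ * (γ * γ) * ⟦ suc t ⟧ →
        FailureBound k (NVM.law ε (proj₁ (K₂₊ p u)) (suc (suc t)))
          (λ ω → P (repetitionRate (suc (suc t)) (NVM.observe ε (proj₁ (K₂₊ p u)) u ω))) δ) →
      Reliable ε (K₂₊ p u) repetitionRate P
    -- At time t + 2 there are t + 1 compared pairs, so the size condition is taken at `suc t`.
    reliable bound δ 0<δ = let T , large = enough δ 0<δ in suc (suc T) , λ where
      (suc (suc t)) (s≤s (s≤s T≤t)) → N , λ k N≤k → bound k N≤k t (ℚ.<⇒≤ 0<δ) (large (suc t) (ℕ.m≤n⇒m≤1+n T≤t))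

  reliably-below : (∀ k → N ≤ k → Unit (seq ε k) × γ ≤ℚ res (a k) μ * (den (a k) μ * θ - num (a k) μ)) →
                   Reliable ε (K₂₊ p u) repetitionRate (λ q → q + q <ℚ 1ℚ + θ)
  reliably-below gap = reliable {λ q → q + q <ℚ 1ℚ + θ} (λ k N≤k t 0≤δ large →
    let ε∈ , γ≤ = gap k N≤k in G.below k ε∈ t 0<γ 0≤δ large γ≤)

  reliably-above : (∀ k → N ≤ k → Unit (seq ε k) × γ ≤ℚ res (a k) μ * (num (a k) μ - den (a k) μ * θ)) →
                   Reliable ε (K₂₊ p u) repetitionRate (λ q → 1ℚ + θ <ℚ q + q)
  reliably-above gap = reliable {λ q → 1ℚ + θ <ℚ q + q} (λ k N≤k t 0≤δ large →
    let ε∈ , γ≤ = gap k N≤k in G.above k ε∈ t 0<γ 0≤δ large γ≤)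

repetition≡rate : ∀ t X → repetition 1 t X ≡ fromℚ (repetitionRate t X)
repetition≡rate t X = average≡averageℚ (repeats 1 t X)

distinguishable-K : ∀ ε → 0ℝ < ε → ε < 1ℝ → ∀ p r → p ≢ r → ∀ u v →
                    Distinguishable ε (K₂₊ p u) (K₂₊ r v) (repetition 1)
-- `coalesce` is not monotone in n: for n = 2, 3, 4 it is 0, 1/4, 2/9. The comparison therefore
-- decides which graph lies above the threshold.
distinguishable-K ε 0<ε ε<1 p r p≢r u v = cases (ℚ.<-cmp (coalesce (+ 1 ℚ./ suc p)) (coalesce (+ 1 ℚ./ suc r)))
  where
  cases : _ → Distinguishable ε (K₂₊ p u) (K₂₊ r v) (repetition 1)
  cases (tri≈ _ eq _) = contradiction (coalesce-injective p r {+ 1 ℚ./ suc p} {+ 1 ℚ./ suc r} (1/n*n (suc p)) (1/n*n (suc r)) eq) p≢r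
  cases (tri< lt _ _) =
    let θ , γ , 0<γ , N , sep = threshold ε 0<ε ε<1 (1/suc∈ p) (1/suc∈ r) lt in
    distinguishable (K₂₊ p u) (K₂₊ r v) {rate = repetitionRate}
      {λ q → q + q <ℚ 1ℚ + θ} {λ q → 1ℚ + θ <ℚ q + q} repetition≡rate
      (λ q → q + q ℚ.<? 1ℚ + θ) (λ q → 1ℚ + θ ℚ.<? q + q) (λ q → ℚ.<-asym)
      (reliably-below ε u 0<γ N (λ k N≤k → proj₁ (sep k N≤k) , proj₁ (proj₂ (sep k N≤k))))
      (reliably-above ε v 0<γ N (λ k N≤k → proj₁ (sep k N≤k) , proj₂ (proj₂ (sep k N≤k))))
  cases (tri> _ _ gt) =
    let θ , γ , 0<γ , N , sep = threshold ε 0<ε ε<1 (1/suc∈ r) (1/suc∈ p) gt in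
    distinguishable (K₂₊ p u) (K₂₊ r v) {rate = repetitionRate}
      {λ q → 1ℚ + θ <ℚ q + q} {λ q → q + q <ℚ 1ℚ + θ} repetition≡rate
      (λ q → 1ℚ + θ ℚ.<? q + q) (λ q → q + q ℚ.<? 1ℚ + θ) (λ q → ℚ.<-asym)
      (reliably-above ε u 0<γ N (λ k N≤k → proj₁ (sep k N≤k) , proj₂ (proj₂ (sep k N≤k))))
      (reliably-below ε v 0<γ N (λ k N≤k → proj₁ (sep k N≤k) , proj₁ (proj₂ (sep k N≤k))))

theorem1p1 : (ε : ℝ) → 0ℝ < ε → ε < 1ℝ →
    (n₁ n₂ : ℕ) (2≤n₁ : 2 ≤ n₁) (2≤n₂ : 2 ≤ n₂) → n₁ ≢ n₂ →
    (u₁ : Fin n₁) (u₂ : Fin n₂) →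
    Distinguishable ε (K n₁ 2≤n₁ , u₁) (K n₂ 2≤n₂ , u₂) (repetition 1)
    ⊎ Distinguishable ε (K n₁ 2≤n₁ , u₁) (K n₂ 2≤n₂ , u₂) (repetition 2)
theorem1p1 ε 0<ε ε<1 (suc (suc p)) (suc (suc r)) (s≤s (s≤s z≤n)) (s≤s (s≤s z≤n)) n₁≢n₂ u₁ u₂ =
  inj₁ (distinguishable-K ε 0<ε ε<1 p r (λ p≡r → n₁≢n₂ (cong (λ m → suc (suc m)) p≡r)) u₁ u₂)
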